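{- For integers $\nu\ge1$ and $n>\nu(3\nu+5)/2$, \[ (-1)^\nu\left(\sum_{\tau=0}^{\nu}(-1)^\tau p\!\left(n-\tfrac{\tau(3\tau+1)}{2}\right)-\sum_{\tau=0}^{\nu-1}(-1)^\tau p\!\left(n-\tfrac{\tau(3\tau+5)}{2}-1\right)\right)=p(2,3,\nu;n)+p(1,3,\nu;n). \]
   Context: $p(n)$ is the number of partitions of $n$. Definition of $M(a,m,\nu;n)$ (integers $\nu\ge0$, $1\le a<m$, $n\ge0$): for a partition $\lambda_1\ge\dots\ge\lambda_k$ of $n$ into parts $\equiv a\pmod m$, put $\ell_i=(\lambda_i-a)/m+1$ (the number of boxes of the row of $\lambda_i$ in the $m$-modular Young diagram), and let $t$ be the largest integer $0\le t\le k$ with $\ell_t\ge t+\nu+2$ (height of the $(\nu+2)$-Durfee rectangle, whose width is $t+\nu+2$). $M(a,m,\nu;n)$ counts partitions of $n$ into parts $\equiv a\pmod m$ in which each of $a,a+m,\dots,a+m\nu$ occurs at least once and $\ell_i<t+\nu+2$ for all $i>t$. Definition: $p(a,m,\nu;n)$ is the number of partitions of $n$ such that, if $\beta$ denotes the sum of the parts $\not\equiv a\pmod m$, the parts $\equiv a\pmod m$ form a partition of $n-\beta$ counted by $M(a,m,\nu;n-\beta)$. -}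

module Defs where

open import Data.Nat using (ℕ; zero; suc; _+_; _*_; _∸_; _≤_; _<_; _≥_; _≟_; _≤?_; _<?_; _≥?_; NonZero)
open import Data.Nat.DivMod using (_/_; _%_)
open import Data.List using (List; []; _∷_; [_]; map; concatMap; upTo; length; filter; drop)
open import Data.Nat.ListAction using (sum)
open import Data.List.Relation.Unary.All using (All; all?)
open import Data.List.Relation.Unary.Linked using (Linked; linked?)
open import Data.List.Membership.DecPropositional _≟_ using (_∈_; _∈?_)
open import Data.Product using (_×_)
open import Data.Unit using (⊤)
open import Relation.Nullary using (Dec; yes; no; ¬?)
open import Relation.Nullary.Decidable using (_×-dec_)
open import Relation.Binary.PropositionalEquality using (_≡_)
open import Data.Integer as ℤ using (ℤ)

IsPartition : ℕ → List ℕ → Set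
IsPartition n xs = Linked _≥_ xs × All (0 <_) xs × sum xs ≡ n

isPartition? : (n : ℕ) → (xs : List ℕ) → Dec (IsPartition n xs)
isPartition? n xs = linked? _≥?_ xs ×-dec all? (0 <?_) xs ×-dec (sum xs ≟ n)

listsOfLen : ℕ → ℕ → List (List ℕ)
listsOfLen n zero    = [ [] ]
listsOfLen n (suc k) = concatMap (λ x → map (x ∷_) (listsOfLen n k)) (map suc (upTo n))

-- all lists of length ≤ n with entries in {1,…,n}; every partition of n
-- occurs exactly once in this list.
candidates : ℕ → List (List ℕ)
candidates n = concatMap (listsOfLen n) (upTo (suc n))

#partitionsWith : (n : ℕ) (Q : List ℕ → Set) → (∀ xs → Dec (Q xs)) → ℕ
#partitionsWith n Q Q? = length (filter (λ xs → isPartition? n xs ×-dec Q? xs) (candidates n))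

p : ℕ → ℕ
p n = #partitionsWith n (λ _ → ⊤) (λ _ → yes Data.Unit.tt)

-- 0-indexed lookup with default 0 (ℓᵢ = at ℓs (i ∸ 1) for 1 ≤ i ≤ k)
at : List ℕ → ℕ → ℕ
at []       _       = 0
at (x ∷ xs) zero    = x
at (x ∷ xs) (suc i) = at xs i

-- ℓᵢ = (λᵢ - a)/m + 1 : number of boxes of the row of λᵢ in the m-modular diagram
rowLengths : (a m : ℕ) .{{_ : NonZero m}} → List ℕ → List ℕ
rowLengths a m xs = map (λ x → (x ∸ a) / m + 1) xs

durfeeAux : List ℕ → ℕ → ℕ → ℕ
durfeeAux ls c zero = 0
durfeeAux ls c (suc j) with suc j + c ≤? at ls j
... | yes _ = suc j
... | no  _ = durfeeAux ls c j

-- height t of the (ν+2)-Durfee rectangle: largest 0 ≤ t ≤ k with ℓₜ ≥ t + ν + 2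
durfeeHeight : (ν : ℕ) → List ℕ → ℕ
durfeeHeight ν ls = durfeeAux ls (ν + 2) (length ls)

MCond : (a m ν : ℕ) .{{_ : NonZero m}} → List ℕ → Set
MCond a m ν xs =
  All (λ j → (a + m * j) ∈ xs) (upTo (suc ν)) ×
  All (_< durfeeHeight ν ls + ν + 2) (drop (durfeeHeight ν ls) ls)
  where ls = rowLengths a m xs

MCond? : (a m ν : ℕ) .{{_ : NonZero m}} → (xs : List ℕ) → Dec (MCond a m ν xs)
MCond? a m ν xs =
  all? (λ j → (a + m * j) ∈? xs) (upTo (suc ν)) ×-dec
  all? (_<? durfeeHeight ν ls + ν + 2) (drop (durfeeHeight ν ls) ls)
  where ls = rowLengths a m xs

_≡[_]_ : ℕ → (m : ℕ) .{{_ : NonZero m}} → ℕ → Set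
x ≡[ m ] a = x % m ≡ a % m

-- parts-condition of M(a,m,ν;N) (the partition-of-N condition is added by the counting)
IsMPart : (a m ν : ℕ) .{{_ : NonZero m}} → List ℕ → Set
IsMPart a m ν xs = All (λ x → x ≡[ m ] a) xs × MCond a m ν xs

IsMPart? : (a m ν : ℕ) .{{_ : NonZero m}} → (xs : List ℕ) → Dec (IsMPart a m ν xs)
IsMPart? a m ν xs = all? (λ x → x % m ≟ a % m) xs ×-dec MCond? a m ν xs

M : (a m ν : ℕ) .{{_ : NonZero m}} → ℕ → ℕ
M a m ν N = #partitionsWith N (IsMPart a m ν) (IsMPart? a m ν)

CountedByM : (a m ν : ℕ) .{{_ : NonZero m}} → ℕ → List ℕ → Set
CountedByM a m ν N xs = IsPartition N xs × IsMPart a m ν xs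

CountedByM? : (a m ν : ℕ) .{{_ : NonZero m}} → (N : ℕ) → (xs : List ℕ) → Dec (CountedByM a m ν N xs)
CountedByM? a m ν N xs = isPartition? N xs ×-dec IsMPart? a m ν xs

partsCong : (a m : ℕ) .{{_ : NonZero m}} → List ℕ → List ℕ
partsCong a m xs = filter (λ x → x % m ≟ a % m) xs

partsNotCong : (a m : ℕ) .{{_ : NonZero m}} → List ℕ → List ℕ
partsNotCong a m xs = filter (λ x → ¬? (x % m ≟ a % m)) xs

PCond : (a m ν : ℕ) .{{_ : NonZero m}} → ℕ → List ℕ → Set
PCond a m ν n xs = CountedByM a m ν (n ∸ sum (partsNotCong a m xs)) (partsCong a m xs)

PCond? : (a m ν : ℕ) .{{_ : NonZero m}} → (n : ℕ) → (xs : List ℕ) → Dec (PCond a m ν n xs)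
PCond? a m ν n xs = CountedByM? a m ν (n ∸ sum (partsNotCong a m xs)) (partsCong a m xs)

pν : (a m ν : ℕ) .{{_ : NonZero m}} → ℕ → ℕ
pν a m ν n = #partitionsWith n (PCond a m ν n) (PCond? a m ν n)

sumTo : ℕ → (ℕ → ℤ) → ℤ
sumTo zero    f = f 0
sumTo (suc k) f = sumTo k f ℤ.+ f (suc k)

{-# OPTIONS --safe #-}

-- Write Q_ν for the partitions counted by p(a,m,ν;n) and i₀ ≥ i₁ ≥ … for the
-- indices (x − a)/m of the parts x ≡ a (mod m).
--
-- (1) Among the partitions of n containing a, a+m, …, a+mν, those outside Q_ν
-- have i_t = t+ν+1, where t is the height of the (ν+2)-Durfee rectangle.
-- Lengthening the first t rows by one box each, deleting row i_t and inserting
-- a row of index ν+1 maps them bijectively to Q_{ν+1}.  Hence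
-- |Q_ν| + |Q_{ν+1}| = p(n − Σ_{j≤ν} (a+mj)), and for m = 3, a = 1, 2 the
-- arguments are the two families of pentagonal shifts.
--
-- (2) For j ∈ ℤ let A_j be the number of partitions of n − j(3j+1)/2 whose largest
-- part is at most t + 3j, t being the number of parts.  The bijection of Bressoud
-- and Zeilberger for Euler's recurrence sends such a partition to
-- (t+3j−1, λ₁−1, …, λ_t−1) and so identifies the partitions counted by A_j with the
-- partitions of n − (j−1)(3j−2)/2 not counted by A_{j−1}.  Hence
-- A_j + A_{j+1} = p(n − j(3j+1)/2).
--
-- The two recurrences agree and their right-hand sides vanish for large ν, so |Q_ν|
-- equals A_{ν+1} for a = 2 and A_{−ν} for a = 1.  Both sums of the theorem
-- telescope, and A₀ cancels from their difference.

module Submission where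

open import Defs
import Data.Integer.Properties as ℤ
import Data.Integer.Tactic.RingSolver as ℤSolver
open import Data.List using (List; []; _∷_; _++_; [_]; map; concatMap; cartesianProductWith; drop; filter; length; replicate; take; upTo)
open import Data.List.Membership.Propositional using (_∈_)
open import Data.List.Membership.Propositional.Properties using (∈-++⁻; ∈-++⁺ʳ; ∈-filter⁺; ∈-filter⁻; ∈-map⁺; ∈-map⁻; ∈-upTo⁺; ∈-upTo⁻; ∈-concat⁺′; ∈-cartesianProductWith⁺; ∈-cartesianProductWith⁻)
open import Data.List.Membership.Propositional.Properties.WithK using (unique∧set⇒bag)
import Data.List.Properties as List
open import Data.List.Relation.Binary.BagAndSetEquality using (∼bag⇒↭)
open import Data.List.Relation.Binary.Permutation.Propositional using (_↭_; prep; swap; ↭-refl; ↭-sym; ↭-trans; ↭⇒↭ₛ; module PermutationReasoning)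
open import Data.List.Relation.Binary.Permutation.Propositional.Properties using (∈-resp-↭; All-resp-↭; drop-∷; ↭-length; filter-↭)
open import Data.List.Relation.Binary.Pointwise using (Pointwise-≡⇒≡)
open import Data.List.Relation.Ternary.Interleaving.Propositional using (toPermutation)
import Data.List.Relation.Ternary.Interleaving.Propositional.Properties as Interleaving
open import Data.List.Relation.Unary.All as All using (All; []; _∷_)
import Data.List.Relation.Unary.All.Properties as All
open import Data.List.Relation.Unary.AllPairs as AllPairs using ([]; _∷_)
import Data.List.Relation.Unary.AllPairs.Properties as AllPairs
open import Data.List.Relation.Unary.Any using (here; there)
open import Data.List.Relation.Unary.Linked as Linked using (Linked; []; [-]; _∷_; linked?)
import Data.List.Relation.Unary.Linked.Properties as Linked
import Data.List.Relation.Unary.Sorted.TotalOrder.Properties as Sorted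
open import Data.List.Relation.Unary.Unique.Propositional using (Unique)
import Data.List.Relation.Unary.Unique.Propositional.Properties as Unique
import Data.List.Sort.InsertionSort as InsertionSort
import Data.List.Sort.InsertionSort.Properties as InsertionSortProperties
open import Data.Nat using (ℕ; zero; suc; pred; _+_; _*_; _∸_; _≤_; _<_; _≥_; z≤n; s≤s; z<s; s<s; _≟_; _≤?_; _<?_; _≥?_; NonZero)
open import Data.List.Membership.DecPropositional _≟_ using (_∈?_)
open import Data.Nat.DivMod using (_/_; _%_; m*n/n≡m; m≡m%n+[m/n]*n; m<n⇒m%n≡m; [m+kn]%n≡m%n; m/n≡1+[m∸n]/n; /-monoˡ-≤)
open import Data.Nat.ListAction using (sum)
open import Data.Nat.ListAction.Properties using (sum-↭; sum-++)
open import Data.Nat.Properties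
open import Data.Nat.Tactic.RingSolver using (solve-∀)
open import Data.Product using (_×_; _,_; proj₁; proj₂)
open import Data.Sum using (inj₁; inj₂)
open import Data.Unit using (tt)
open import Function using (_∘_; id; flip; mk⇔)
open import Level using (Level; 0ℓ; _⊔_)
open import Relation.Binary.Bundles using (DecTotalOrder)
import Relation.Binary.Construct.Flip.EqAndOrd as Flip
open import Relation.Binary.PropositionalEquality using (_≡_; _≢_; refl; sym; trans; cong; cong₂; subst; module ≡-Reasoning)
open import Relation.Nullary using (yes; no; ¬_; contradiction)
open import Relation.Nullary.Decidable using (_×-dec_)
open import Relation.Unary using (Pred; Decidable; ∁; _⊆_; _≐_; _∩_)
open import Relation.Unary.Properties using (_∩?_; ∁?; U?)

-- Counting by bijections

module _ {a p q : Level} {A B : Set a} where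

  Embeds : (f : A → B) (g : B → A) → Pred A p → Pred B q → Set (a ⊔ p ⊔ q)
  Embeds f g P Q = ∀ {x} → P x → Q (f x) × g (f x) ≡ x

infix 4 _≅_

record _≅_ {a p q : Level} {A B : Set a} (P : Pred A p) (Q : Pred B q) : Set (a ⊔ p ⊔ q) where
  field
    to          : A → B
    from        : B → A
    to-embeds   : Embeds to from P Q
    from-embeds : Embeds from to Q P

module _ {a p : Level} {A : Set a} where

  count : {P : Pred A p} → Decidable P → List A → ℕ
  count P? xs = length (filter P? xs)

  Enumerates : List A → Pred A p → Set (a ⊔ p)
  Enumerates xs P = Unique xs × P ⊆ (_∈ xs)

module _ {a p q : Level} {A : Set a} {P : Pred A p} {Q : Pred A q} (P? : Decidable P) (Q? : Decidable Q) where

  count-≐ : P ≐ Q → ∀ xs → count P? xs ≡ count Q? xs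
  count-≐ P≐Q xs = cong length (List.filter-≐ P? Q? P≐Q xs)

  count-∩-∁ : ∀ xs → count P? xs ≡ count (P? ∩? Q?) xs + count (P? ∩? ∁? Q?) xs
  count-∩-∁ []       = refl
  count-∩-∁ (x ∷ xs) with P? x | Q? x
  ... | yes _ | yes _ = cong suc (count-∩-∁ xs)
  ... | yes _ | no _  = trans (cong suc (count-∩-∁ xs)) (sym (+-suc _ _))
  ... | no _  | _     = count-∩-∁ xs

module _ {a p q : Level} {A B : Set a} {P : Pred A p} {Q : Pred B q} (P? : Decidable P) (Q? : Decidable Q) where

  count-≅ : ∀ {xs ys} → Enumerates xs P → Enumerates ys Q → P ≅ Q → count P? xs ≡ count Q? ys
  count-≅ {xs} {ys} (xs! , P⊆xs) (ys! , Q⊆ys) P≅Q = begin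
    length (filter P? xs)          ≡⟨ List.length-map to (filter P? xs) ⟨
    length (map to (filter P? xs)) ≡⟨ ↭-length image↭ ⟩
    length (filter Q? ys)          ∎
    where
    open ≡-Reasoning
    open _≅_ P≅Q

    from∘to : map from (map to (filter P? xs)) ≡ filter P? xs
    from∘to = trans (sym (List.map-∘ (filter P? xs)))
      (List.map-id-local (All.map (proj₂ ∘ to-embeds) (All.all-filter P? xs)))

    image! : Unique (map to (filter P? xs))
    image! = Unique.map⁻ (subst Unique (sym from∘to) (Unique.filter⁺ P? xs!))

    image⊆ : ∀ {y} → y ∈ map to (filter P? xs) → y ∈ filter Q? ys
    image⊆ y∈ with ∈-map⁻ to y∈
    ... | x , x∈ , refl = ∈-filter⁺ Q? (Q⊆ys Qfx) Qfx
      where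
      Qfx : Q (to x)
      Qfx = proj₁ (to-embeds (proj₂ (∈-filter⁻ P? {xs = xs} x∈)))

    ⊆image : ∀ {y} → y ∈ filter Q? ys → y ∈ map to (filter P? xs)
    ⊆image y∈ with from-embeds (proj₂ (∈-filter⁻ Q? {xs = ys} y∈))
    ... | Pgy , fgy≡y = subst (_∈ _) fgy≡y (∈-map⁺ to (∈-filter⁺ P? (P⊆xs Pgy) Pgy))

    image↭ : map to (filter P? xs) ↭ filter Q? ys
    image↭ = ∼bag⇒↭ (unique∧set⇒bag image! (Unique.filter⁺ Q? ys!) (mk⇔ image⊆ ⊆image))

-- Enumerating partitions

concatMap-map≡cartesianProductWith : ∀ {a b c} {A : Set a} {B : Set b} {C : Set c} (f : A → B → C) xs ys →
  concatMap (λ x → map (f x) ys) xs ≡ cartesianProductWith f xs ys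
concatMap-map≡cartesianProductWith f []       ys = refl
concatMap-map≡cartesianProductWith f (x ∷ xs) ys =
  cong (map (f x) ys ++_) (concatMap-map≡cartesianProductWith f xs ys)

listsOfLen-suc : ∀ n k →
  listsOfLen n (suc k) ≡ cartesianProductWith _∷_ (map suc (upTo n)) (listsOfLen n k)
listsOfLen-suc n k = concatMap-map≡cartesianProductWith _∷_ (map suc (upTo n)) (listsOfLen n k)

listsOfLen-unique : ∀ n k → Unique (listsOfLen n k)
listsOfLen-unique n zero    = [] ∷ []
listsOfLen-unique n (suc k) = subst Unique (sym (listsOfLen-suc n k))
  (Unique.cartesianProductWith⁺ _∷_ List.∷-injective
    (Unique.map⁺ suc-injective (Unique.upTo⁺ n)) (listsOfLen-unique n k))

listsOfLen-length : ∀ n k {xs} → xs ∈ listsOfLen n k → length xs ≡ k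
listsOfLen-length n zero    (here refl) = refl
listsOfLen-length n (suc k) xs∈
  with ∈-cartesianProductWith⁻ _∷_ (map suc (upTo n)) (listsOfLen n k)
         (subst (_ ∈_) (listsOfLen-suc n k) xs∈)
... | _ , _ , _ , ys∈ , refl = cong suc (listsOfLen-length n k ys∈)

∈-listsOfLen : ∀ n {xs} → All (0 <_) xs → All (_≤ n) xs → xs ∈ listsOfLen n (length xs)
∈-listsOfLen n []       []       = here refl
∈-listsOfLen n {_ ∷ xs} (z<s ∷ pos) (x≤n ∷ xs≤n) =
  subst (_ ∈_) (sym (listsOfLen-suc n (length xs)))
    (∈-cartesianProductWith⁺ _∷_ (∈-map⁺ suc (∈-upTo⁺ x≤n)) (∈-listsOfLen n pos xs≤n))

candidates-unique : ∀ n → Unique (candidates n)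
candidates-unique n = Unique.concat⁺
  (All.map⁺ (All.universal (listsOfLen-unique n) (upTo (suc n))))
  (AllPairs.map⁺ (AllPairs.map disjoint (Unique.upTo⁺ (suc n))))
  where
  disjoint : ∀ {i j} → i ≢ j → ∀ {xs} → ¬ (xs ∈ listsOfLen n i × xs ∈ listsOfLen n j)
  disjoint i≢j (∈i , ∈j) =
    i≢j (trans (sym (listsOfLen-length n _ ∈i)) (listsOfLen-length n _ ∈j))

all≤sum : ∀ xs → All (_≤ sum xs) xs
all≤sum []       = []
all≤sum (x ∷ xs) = m≤m+n x _ ∷ All.map (m≤n⇒m≤o+n x) (all≤sum xs)

length≤sum : ∀ {xs} → All (0 <_) xs → length xs ≤ sum xs
length≤sum []          = z≤n
length≤sum (x>0 ∷ pos) = +-mono-≤ x>0 (length≤sum pos)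

∈-candidates : ∀ {n xs} → All (0 <_) xs → sum xs ≤ n → xs ∈ candidates n
∈-candidates {n} {xs} pos sum≤n = ∈-concat⁺′
  (∈-listsOfLen n pos (All.map (flip ≤-trans sum≤n) (all≤sum xs)))
  (∈-map⁺ (listsOfLen n) (∈-upTo⁺ (s≤s (≤-trans (length≤sum pos) sum≤n))))

Desc : Pred (List ℕ) 0ℓ
Desc = Linked _≥_

-- A partition of n − e.  Keeping e on the side of the sum makes the number of
-- these vanish for e > n, where truncated subtraction would count the empty partition.
Partition : (n e : ℕ) → Pred (List ℕ) 0ℓ
Partition n e xs = Desc xs × All (0 <_) xs × sum xs + e ≡ n

partition? : ∀ n e → Decidable (Partition n e)
partition? n e xs = linked? _≥?_ xs ×-dec All.all? (0 <?_) xs ×-dec (sum xs + e ≟ n)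

#[_-_] : (n e : ℕ) {Q : Pred (List ℕ) 0ℓ} → Decidable Q → ℕ
#[ n - e ] Q? = count (partition? n e ∩? Q?) (candidates n)

p[_-_] : ℕ → ℕ → ℕ
p[ n - e ] = #[ n - e ] U?

candidates-enumerate : ∀ n e {Q : Pred (List ℕ) 0ℓ} → Enumerates (candidates n) (Partition n e ∩ Q)
candidates-enumerate n e = candidates-unique n ,
  λ {xs} ((_ , pos , sum≡) , _) → ∈-candidates pos (≤-trans (m≤m+n (sum xs) e) (≤-reflexive sum≡))

module _ (n e : ℕ) {Q : Pred (List ℕ) 0ℓ} (Q? : Decidable Q) where

  #-≅ : ∀ {e′ Q′} (Q′? : Decidable Q′) → Partition n e ∩ Q ≅ Partition n e′ ∩ Q′ →
    #[ n - e ] Q? ≡ #[ n - e′ ] Q′?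
  #-≅ {e′} Q′? = count-≅ (partition? n e ∩? Q?) (partition? n e′ ∩? Q′?)
    (candidates-enumerate n e) (candidates-enumerate n e′)

  #-cong : ∀ {Q′} (Q′? : Decidable Q′) → (∀ {xs} → Partition n e xs → Q xs → Q′ xs) →
    (∀ {xs} → Partition n e xs → Q′ xs → Q xs) → #[ n - e ] Q? ≡ #[ n - e ] Q′?
  #-cong Q′? Q⊆Q′ Q′⊆Q = count-≐ (partition? n e ∩? Q?) (partition? n e ∩? Q′?)
    ((λ (P , q) → P , Q⊆Q′ P q) , (λ (P , q) → P , Q′⊆Q P q)) (candidates n)

  #-vanishes : n < e → #[ n - e ] Q? ≡ 0
  #-vanishes n<e = cong length (List.filter-none (partition? n e ∩? Q?)
    (All.universal (λ xs ((_ , _ , sum≡) , _) → <⇒≱ n<e (m+n≤o⇒n≤o (sum xs) (≤-reflexive sum≡))) (candidates n)))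

  #-∩-∁ : ∀ {R} (R? : Decidable R) →
    #[ n - e ] Q? ≡ #[ n - e ] (Q? ∩? R?) + #[ n - e ] (Q? ∩? ∁? R?)
  #-∩-∁ {R} R? = begin
    count (partition? n e ∩? Q?) (candidates n)
      ≡⟨ count-∩-∁ (partition? n e ∩? Q?) R? (candidates n) ⟩
    count ((partition? n e ∩? Q?) ∩? R?) (candidates n) +
    count ((partition? n e ∩? Q?) ∩? ∁? R?) (candidates n)
      ≡⟨ cong₂ _+_ (reassociate R?) (reassociate (∁? R?)) ⟩
    #[ n - e ] (Q? ∩? R?) + #[ n - e ] (Q? ∩? ∁? R?) ∎
    where
    open ≡-Reasoning
    reassociate : ∀ {S} (S? : Decidable S) →
      count ((partition? n e ∩? Q?) ∩? S?) (candidates n) ≡ #[ n - e ] (Q? ∩? S?)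
    reassociate S? = count-≐ ((partition? n e ∩? Q?) ∩? S?) (partition? n e ∩? (Q? ∩? S?))
      ((λ ((P , q) , s) → P , q , s) , (λ (P , q , s) → (P , q) , s)) (candidates n)

#-∁ : ∀ n e {Q} (Q? : Decidable Q) → p[ n - e ] ≡ #[ n - e ] Q? + #[ n - e ] (∁? Q?)
#-∁ n e Q? = trans (#-∩-∁ n e U? Q?) (cong₂ _+_
  (#-cong n e (U? ∩? Q?) Q? (λ _ → proj₂) (λ _ → tt ,_))
  (#-cong n e (U? ∩? ∁? Q?) (∁? Q?) (λ _ → proj₂) (λ _ → tt ,_)))

p-∸ : ∀ {n e} → e ≤ n → p (n ∸ e) ≡ p[ n - e ]
p-∸ {n} {e} e≤n = count-≅ (λ xs → isPartition? (n ∸ e) xs ×-dec yes tt) (partition? n e ∩? U?)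
  (candidates-unique (n ∸ e) , λ ((_ , pos , sum≡) , _) → ∈-candidates pos (≤-reflexive sum≡))
  (candidates-enumerate n e)
  (record
    { to = id
    ; from = id
    ; to-embeds = λ ((d , pos , sum≡) , _) →
        ((d , pos , trans (cong (_+ e) sum≡) (m∸n+n≡m e≤n)) , tt) , refl
    ; from-embeds = λ {xs} ((d , pos , sum≡) , _) →
        ((d , pos , trans (sym (m+n∸n≡m (sum xs) e)) (cong (_∸ e) sum≡)) , tt) , refl
    })

-- Descending lists

≥-decTotalOrder : DecTotalOrder 0ℓ 0ℓ 0ℓ
≥-decTotalOrder = Flip.decTotalOrder ≤-decTotalOrder

open DecTotalOrder ≥-decTotalOrder using () renaming (totalOrder to ≥-totalOrder; trans to ≥-trans)
open InsertionSort ≥-decTotalOrder using (insert; sort)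
open InsertionSortProperties ≥-decTotalOrder using (insert-↭; insert-↗; sort-↭; sort-↗)

desc-head : ∀ {x xs} → Desc (x ∷ xs) → All (_≤ x) xs
desc-head d = AllPairs.head (Linked.Linked⇒AllPairs ≥-trans d)

desc-++ : ∀ {b xs ys} → Desc xs → Desc ys → All (b ≤_) xs → All (_≤ b) ys → Desc (xs ++ ys)
desc-++ xs↘ ys↘ b≤xs ys≤b = Linked.AllPairs⇒Linked
  (AllPairs.++⁺ (Linked.Linked⇒AllPairs ≥-trans xs↘) (Linked.Linked⇒AllPairs ≥-trans ys↘)
    (All.map (λ b≤x → All.map (λ y≤b → ≤-trans y≤b b≤x) ys≤b) b≤xs))

desc-∷ : ∀ {x xs} → All (_≤ x) xs → Desc xs → Desc (x ∷ xs)
desc-∷ xs≤x xs↘ = desc-++ [-] xs↘ (≤-refl ∷ []) xs≤x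

desc-map : ∀ {f : ℕ → ℕ} → (∀ {i j} → i ≤ j → f i ≤ f j) → ∀ {xs} → Desc xs → Desc (map f xs)
desc-map mono xs↘ = Linked.map⁺ (Linked.map mono xs↘)

desc-↭⇒≡ : ∀ {xs ys} → Desc xs → Desc ys → xs ↭ ys → xs ≡ ys
desc-↭⇒≡ xs↘ ys↘ xs↭ys = Pointwise-≡⇒≡ (Sorted.↗↭↗⇒≋ ≥-totalOrder xs↘ ys↘ (↭⇒↭ₛ xs↭ys))

∈-insert : ∀ x xs → x ∈ insert x xs
∈-insert x xs = ∈-resp-↭ (↭-sym (insert-↭ x xs)) (here refl)

∈-insert⁺ : ∀ x {y xs} → y ∈ xs → y ∈ insert x xs
∈-insert⁺ x {xs = xs} y∈ = ∈-resp-↭ (↭-sym (insert-↭ x xs)) (there y∈)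

all-insert : ∀ {P : Pred ℕ 0ℓ} {x xs} → P x → All P xs → All P (insert x xs)
all-insert {x = x} {xs} Px Pxs = All-resp-↭ (↭-sym (insert-↭ x xs)) (Px ∷ Pxs)

delete : ℕ → List ℕ → List ℕ
delete x []       = []
delete x (y ∷ ys) with x ≟ y
... | yes _ = ys
... | no  _ = y ∷ delete x ys

delete-↭ : ∀ {x xs} → x ∈ xs → x ∷ delete x xs ↭ xs
delete-↭ {x} {y ∷ ys} x∈ with x ≟ y | x∈
... | yes refl | _         = ↭-refl
... | no x≢y   | here x≡y  = contradiction x≡y x≢y
... | no x≢y   | there x∈ys = ↭-trans (swap x y ↭-refl) (prep y (delete-↭ x∈ys))

all-delete : ∀ {P : Pred ℕ 0ℓ} x {xs} → All P xs → All P (delete x xs)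
all-delete x [] = []
all-delete x {y ∷ ys} (Py ∷ Pys) with x ≟ y
... | yes _ = Pys
... | no  _ = Py ∷ all-delete x Pys

desc-delete : ∀ x {xs} → Desc xs → Desc (delete x xs)
desc-delete x {[]} d = []
desc-delete x {y ∷ ys} d with x ≟ y
... | yes _ = Linked.tail d
... | no  _ = desc-∷ (all-delete x (desc-head d)) (desc-delete x (Linked.tail d))

∈-delete⁺ : ∀ {x y xs} → x ∈ xs → y ≢ x → y ∈ xs → y ∈ delete x xs
∈-delete⁺ x∈ y≢x y∈ with ∈-resp-↭ (↭-sym (delete-↭ x∈)) y∈
... | here y≡x  = contradiction y≡x y≢x
... | there y∈′ = y∈′

delete-insert : ∀ x {xs} → Desc xs → delete x (insert x xs) ≡ xs
delete-insert x {xs} d = desc-↭⇒≡ (desc-delete x (insert-↗ x d)) d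
  (drop-∷ (↭-trans (delete-↭ (∈-insert x xs)) (insert-↭ x xs)))

insert-delete : ∀ {x xs} → Desc xs → x ∈ xs → insert x (delete x xs) ≡ xs
insert-delete {x} {xs} d x∈ = desc-↭⇒≡ (insert-↗ x (desc-delete x d)) d
  (↭-trans (insert-↭ x (delete x xs)) (delete-↭ x∈))

Containing : List ℕ → Pred (List ℕ) 0ℓ
Containing ds xs = All (_∈ xs) ds

containing? : ∀ ds → Decidable (Containing ds)
containing? ds xs = All.all? (_∈? xs) ds

insertion : ∀ {n e d ds} → 0 < d → All (d ≢_) ds →
  Partition n (d + e) ∩ Containing ds ≅ Partition n e ∩ Containing (d ∷ ds)
insertion {n} {e} {d} {ds} d>0 d∉ds = record
  { to = insert d ; from = delete d ; to-embeds = insert-embeds ; from-embeds = delete-embeds }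
  where
  swap-summands : ∀ d s e → d + s + e ≡ s + (d + e)
  swap-summands = solve-∀

  insert-embeds : Embeds (insert d) (delete d)
    (Partition n (d + e) ∩ Containing ds) (Partition n e ∩ Containing (d ∷ ds))
  insert-embeds {xs} ((xs↘ , pos , sum≡) , ds∈) =
    ((insert-↗ d xs↘ , all-insert d>0 pos ,
      trans (cong (_+ e) (sum-↭ (insert-↭ d xs))) (trans (swap-summands d (sum xs) e) sum≡)) ,
     ∈-insert d xs ∷ All.map (∈-insert⁺ d) ds∈) ,
    delete-insert d xs↘

  delete-embeds : Embeds (delete d) (insert d)
    (Partition n e ∩ Containing (d ∷ ds)) (Partition n (d + e) ∩ Containing ds)
  delete-embeds {xs} ((xs↘ , pos , sum≡) , d∈ ∷ ds∈) =
    ((desc-delete d xs↘ , all-delete d pos ,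
      trans (sym (swap-summands d (sum (delete d xs)) e))
        (trans (cong (_+ e) (sum-↭ (delete-↭ d∈))) sum≡)) ,
     All.map (λ (d≢ , x∈) → ∈-delete⁺ d∈ (d≢ ∘ sym) x∈) (All.zip (d∉ds , ds∈))) ,
    insert-delete xs↘ d∈

#-containing : ∀ {n} e {ds} → All (0 <_) ds → Unique ds →
  #[ n - e ] (containing? ds) ≡ p[ n - sum ds + e ]
#-containing {n} e [] [] = #-cong n e (containing? []) U? (λ _ _ → tt) (λ _ _ → [])
#-containing {n} e {d ∷ ds} (d>0 ∷ pos) (d∉ds ∷ ds!) = begin
  #[ n - e ] (containing? (d ∷ ds))
    ≡⟨ #-≅ n (d + e) (containing? ds) (containing? (d ∷ ds)) (insertion d>0 d∉ds) ⟨
  #[ n - d + e ] (containing? ds)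
    ≡⟨ #-containing (d + e) pos ds! ⟩
  p[ n - sum ds + (d + e) ]
    ≡⟨ cong p[ n -_] (rearrange (sum ds) d e) ⟩
  p[ n - d + sum ds + e ] ∎
  where
  open ≡-Reasoning
  rearrange : ∀ s d e → s + (d + e) ≡ d + s + e
  rearrange = solve-∀

take-length-++ : ∀ {a} {A : Set a} (xs ys : List A) → take (length xs) (xs ++ ys) ≡ xs
take-length-++ []       ys = refl
take-length-++ (x ∷ xs) ys = cong (x ∷_) (take-length-++ xs ys)

drop-length-++ : ∀ {a} {A : Set a} (xs ys : List A) → drop (length xs) (xs ++ ys) ≡ ys
drop-length-++ []       ys = refl
drop-length-++ (x ∷ xs) ys = drop-length-++ xs ys

sum-map-suc : ∀ xs → sum (map suc xs) ≡ sum xs + length xs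
sum-map-suc []       = refl
sum-map-suc (x ∷ xs) = trans (cong (suc x +_) (sum-map-suc xs)) (rearrange x (sum xs) (length xs))
  where
  rearrange : ∀ x s l → suc x + (s + l) ≡ x + s + suc l
  rearrange = solve-∀

map-pred-suc : ∀ xs → map pred (map suc xs) ≡ xs
map-pred-suc xs = trans (sym (List.map-∘ xs)) (List.map-id xs)

map-suc-pred : ∀ {xs} → All (0 <_) xs → map suc (map pred xs) ≡ xs
map-suc-pred {xs} pos = trans (sym (List.map-∘ xs)) (List.map-id-local (All.map (λ { z<s → refl }) pos))

at-≤ : ∀ {b xs} j → All (_≤ b) xs → at xs j ≤ b
at-≤ j       []         = z≤n
at-≤ zero    (x≤b ∷ _)  = x≤b
at-≤ (suc j) (_ ∷ xs≤b) = at-≤ j xs≤b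

-- Durfee rectangles

-- The height of the largest rectangle t × (t + c) inside the diagram with rows xs.
durfee : ℕ → List ℕ → ℕ
durfee c xs = durfeeAux xs c (length xs)

durfeeAux-∷ : ∀ {c x} xs j → c < x → durfeeAux (x ∷ xs) c (suc j) ≡ suc (durfeeAux xs (suc c) j)
durfeeAux-∷ {c} {x} xs zero c<x with suc c ≤? x
... | yes _   = refl
... | no  c≮x = contradiction c<x c≮x
durfeeAux-∷ {c} xs (suc j) c<x with suc (suc j) + c ≤? at xs j | suc j + suc c ≤? at xs j
... | yes _ | yes _ = refl
... | no  _ | no  _ = durfeeAux-∷ xs j c<x
... | yes p | no ¬q = contradiction (subst (_≤ at xs j) (cong suc (sym (+-suc j c))) p) ¬q
... | no ¬p | yes q = contradiction (subst (_≤ at xs j) (cong suc (+-suc j c)) q) ¬p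

durfeeAux-≤ : ∀ {c xs} j → All (_≤ c) xs → durfeeAux xs c j ≡ 0
durfeeAux-≤ zero xs≤c = refl
durfeeAux-≤ {c} {xs} (suc j) xs≤c with suc j + c ≤? at xs j
... | yes p = contradiction (≤-trans p (at-≤ j xs≤c)) (<⇒≱ (s≤s (m≤n+m c j)))
... | no  _ = durfeeAux-≤ j xs≤c

-- The Durfee rectangle of ys ++ zs meets exactly the rows ys.
record DurfeeShape (c : ℕ) (ys zs : List ℕ) : Set where
  field
    above-desc : Desc ys
    below-desc : Desc zs
    above≥     : All (length ys + c ≤_) ys
    below≤     : All (_≤ length ys + c) zs

open DurfeeShape

durfee-++ : ∀ {c} ys {zs} → All (length ys + c ≤_) ys → All (_≤ length ys + c) zs →
  durfee c (ys ++ zs) ≡ length ys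
durfee-++ [] {zs} [] zs≤ = durfeeAux-≤ (length zs) zs≤
durfee-++ {c} (y ∷ ys) {zs} (y≥ ∷ ys≥) zs≤ = begin
  durfee c (y ∷ ys ++ zs)         ≡⟨ durfeeAux-∷ (ys ++ zs) (length (ys ++ zs)) c<y ⟩
  suc (durfee (suc c) (ys ++ zs)) ≡⟨ cong suc (durfee-++ ys ys≥′ zs≤′) ⟩
  suc (length ys)                 ∎
  where
  open ≡-Reasoning
  shift : suc (length ys) + c ≡ length ys + suc c
  shift = sym (+-suc (length ys) c)
  c<y : c < y
  c<y = ≤-trans (s≤s (m≤n+m c (length ys))) y≥
  ys≥′ : All (length ys + suc c ≤_) ys
  ys≥′ = subst (λ b → All (b ≤_) ys) shift ys≥
  zs≤′ : All (_≤ length ys + suc c) zs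
  zs≤′ = subst (λ b → All (_≤ b) zs) shift zs≤

durfee-shape : ∀ {c ys zs} → DurfeeShape c ys zs → durfee c (ys ++ zs) ≡ length ys
durfee-shape {ys = ys} S = durfee-++ ys (above≥ S) (below≤ S)

desc-shape : ∀ {c ys zs} → DurfeeShape c ys zs → Desc (ys ++ zs)
desc-shape S = desc-++ (above-desc S) (below-desc S) (above≥ S) (below≤ S)

data DurfeeSplit (c : ℕ) : List ℕ → Set where
  split : ∀ {ys zs} → DurfeeShape c ys zs → DurfeeSplit c (ys ++ zs)

durfeeSplit : ∀ c {xs} → Desc xs → DurfeeSplit c xs
durfeeSplit c {[]} d = split record { above-desc = [] ; below-desc = [] ; above≥ = [] ; below≤ = [] }
durfeeSplit c {x ∷ xs} d with c <? x
... | no  c≮x = split {ys = []} record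
  { above-desc = []
  ; below-desc = d
  ; above≥     = []
  ; below≤     = ≮⇒≥ c≮x ∷ All.map (λ y≤x → ≤-trans y≤x (≮⇒≥ c≮x)) (desc-head d)
  }
... | yes c<x with durfeeSplit (suc c) (Linked.tail d)
...   | split {ys} {zs} S = split {ys = x ∷ ys} record
  { above-desc = desc-∷ ys≤x (above-desc S)
  ; below-desc = below-desc S
  ; above≥     = subst (λ b → All (b ≤_) (x ∷ ys)) (+-suc (length ys) c)
                   (x≥ ys (above≥ S) ys≤x ∷ above≥ S)
  ; below≤     = subst (λ b → All (_≤ b) zs) (+-suc (length ys) c) (below≤ S)
  }
  where
  ys≤x : All (_≤ x) ys
  ys≤x = All.++⁻ˡ ys (desc-head d)

  x≥ : ∀ ys → All (length ys + suc c ≤_) ys → All (_≤ x) ys → length ys + suc c ≤ x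
  x≥ []      []        []        = c<x
  x≥ (_ ∷ _) (b≤y ∷ _) (y≤x ∷ _) = ≤-trans b≤y y≤x

NarrowBelow : ℕ → Pred (List ℕ) 0ℓ
NarrowBelow c xs = All (_< durfee c xs + c) (drop (durfee c xs) xs)

narrowBelow? : ∀ c → Decidable (NarrowBelow c)
narrowBelow? c xs = All.all? (_<? durfee c xs + c) (drop (durfee c xs) xs)

narrowBelow-++ : ∀ {c ys zs} → DurfeeShape c ys zs →
  NarrowBelow c (ys ++ zs) ≡ All (_< length ys + c) zs
narrowBelow-++ {c} {ys} {zs} S = trans
  (cong (λ t → All (_< t + c) (drop t (ys ++ zs))) (durfee-shape S))
  (cong (All (_< length ys + c)) (drop-length-++ ys zs))

replaceBelow : ∀ {c ys zs zs′} → DurfeeShape c ys zs → Desc zs′ → All (_≤ length ys + c) zs′ →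
  DurfeeShape c ys zs′
replaceBelow S zs′↘ zs′≤ = record
  { above-desc = above-desc S ; below-desc = zs′↘ ; above≥ = above≥ S ; below≤ = zs′≤ }

shape-∷ : ∀ {c ys zs} → DurfeeShape c ys zs → DurfeeShape c ys (length ys + c ∷ zs)
shape-∷ S = replaceBelow S (desc-∷ (below≤ S) (below-desc S)) (≤-refl ∷ below≤ S)

shape-insert : ∀ {c ys zs x} → x ≤ length ys + c → DurfeeShape c ys zs → DurfeeShape c ys (insert x zs)
shape-insert {x = x} x≤ S = replaceBelow S (insert-↗ x (below-desc S)) (all-insert x≤ (below≤ S))

shape-delete : ∀ {c ys zs} x → DurfeeShape c ys zs → DurfeeShape c ys (delete x zs)
shape-delete x S = replaceBelow S (desc-delete x (below-desc S)) (all-delete x (below≤ S))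

width-map-suc : ∀ c ys → length (map suc ys) + suc c ≡ suc (length ys + c)
width-map-suc c ys = trans (cong (_+ suc c) (List.length-map suc ys)) (+-suc (length ys) c)

shape-map-suc : ∀ {c ys zs} → DurfeeShape c ys zs → DurfeeShape (suc c) (map suc ys) zs
shape-map-suc {c} {ys} {zs} S = record
  { above-desc = desc-map s≤s (above-desc S)
  ; below-desc = below-desc S
  ; above≥     = subst (λ b → All (b ≤_) (map suc ys)) width≡ (All.map⁺ (All.map s≤s (above≥ S)))
  ; below≤     = subst (λ b → All (_≤ b) zs) width≡ (All.map m≤n⇒m≤1+n (below≤ S))
  }
  where
  width≡ : suc (length ys + c) ≡ length (map suc ys) + suc c
  width≡ = sym (width-map-suc c ys)

∈-below : ∀ {c ys zs j} → DurfeeShape c ys zs → j < c → j ∈ ys ++ zs → j ∈ zs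
∈-below {c} {ys} S j<c j∈ with ∈-++⁻ ys j∈
... | inj₁ j∈ys = contradiction (≤-trans (m≤n+m c (length ys)) (All.lookup (above≥ S) j∈ys)) (<⇒≱ j<c)
... | inj₂ j∈zs = j∈zs

data WideSplit (c : ℕ) : List ℕ → Set where
  wide : ∀ {ys zs} → DurfeeShape c ys zs → WideSplit c (ys ++ length ys + c ∷ zs)

data NarrowSplit (c : ℕ) : List ℕ → Set where
  narrow : ∀ {ys zs} → DurfeeShape c ys zs → NarrowSplit c (map suc ys ++ zs)

wideSplit : ∀ c {xs} → Desc xs → ¬ NarrowBelow c xs → WideSplit c xs
wideSplit c d ¬narrow with durfeeSplit c d
... | split {ys} {[]}     S = contradiction (subst id (sym (narrowBelow-++ S)) []) ¬narrow
... | split {ys} {z ∷ zs} S with m≤n⇒m<n∨m≡n (All.head (below≤ S))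
...   | inj₁ z<   = contradiction (subst id (sym (narrowBelow-++ S)) (z< ∷ zs<)) ¬narrow
  where
  zs< : All (_< length ys + c) zs
  zs< = All.map (λ y≤z → ≤-<-trans y≤z z<) (desc-head (below-desc S))
...   | inj₂ refl = wide (replaceBelow S (Linked.tail (below-desc S)) (All.tail (below≤ S)))

narrowSplit : ∀ c {xs} → Desc xs → NarrowBelow (suc c) xs → NarrowSplit c xs
narrowSplit c d below with durfeeSplit (suc c) d
... | split {ys} {zs} S = subst (λ xs → NarrowSplit c (xs ++ zs)) (map-suc-pred ys>0) (narrow record
  { above-desc = desc-map pred-mono-≤ (above-desc S)
  ; below-desc = below-desc S
  ; above≥     = All.map⁺ (All.map (pred-mono-≤ ∘ ≤-trans (≤-reflexive width≡)) (above≥ S))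
  ; below≤     = All.map (λ z< → ≤-pred (≤-trans z< (≤-reflexive (sym width≡)))) zs<
  })
  where
  zs< : All (_< length ys + suc c) zs
  zs< = subst id (narrowBelow-++ S) below
  width≡ : suc (length (map pred ys) + c) ≡ length ys + suc c
  width≡ = trans (cong (λ l → suc (l + c)) (List.length-map pred ys)) (sym (+-suc (length ys) c))
  ys>0 : All (0 <_) ys
  ys>0 = All.map (≤-trans (m≤n⇒m≤o+n (length ys) z<s)) (above≥ S)

lengthen : ℕ → List ℕ → List ℕ
lengthen c xs = map suc (take t xs) ++ insert c (drop 1 (drop t xs))
  where
  t : ℕ
  t = durfee c xs

shorten : ℕ → List ℕ → List ℕ
shorten c xs = map pred (take t xs) ++ t + c ∷ delete c (drop t xs)
  where
  t : ℕ
  t = durfee (suc c) xs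

module _ {c : ℕ} {ys zs : List ℕ} (S : DurfeeShape c ys zs) where

  lengthen-wide : lengthen c (ys ++ length ys + c ∷ zs) ≡ map suc ys ++ insert c zs
  lengthen-wide
    rewrite durfee-shape (shape-∷ S)
          | take-length-++ ys (length ys + c ∷ zs)
          | drop-length-++ ys (length ys + c ∷ zs) = refl

  shorten-narrow : shorten c (map suc ys ++ zs) ≡ ys ++ length ys + c ∷ delete c zs
  shorten-narrow
    rewrite durfee-shape (shape-map-suc S)
          | take-length-++ (map suc ys) zs
          | drop-length-++ (map suc ys) zs
          | map-pred-suc ys
          | List.length-map suc ys = refl

  narrow⇒narrowBelow : NarrowBelow (suc c) (map suc ys ++ zs)
  narrow⇒narrowBelow = subst id (sym (narrowBelow-++ (shape-map-suc S)))
    (subst (λ b → All (_< b) zs) (sym (width-map-suc c ys)) (All.map s≤s (below≤ S)))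

  wide⇒¬narrowBelow : ¬ NarrowBelow c (ys ++ length ys + c ∷ zs)
  wide⇒¬narrowBelow below = <-irrefl refl (All.head (subst id (narrowBelow-++ (shape-∷ S)) below))

  ∈-below-wide : ∀ {j} → j < c → j ∈ ys ++ length ys + c ∷ zs → j ∈ zs
  ∈-below-wide j<c j∈ with ∈-below (shape-∷ S) j<c j∈
  ... | here refl  = contradiction (m≤n+m c (length ys)) (<⇒≱ j<c)
  ... | there j∈zs = j∈zs

containing-upTo⁺ : ∀ {k xs} → (∀ {j} → j < k → j ∈ xs) → Containing (upTo k) xs
containing-upTo⁺ mem = All.tabulate (mem ∘ ∈-upTo⁻)

containing-upTo⁻ : ∀ {k xs} → Containing (upTo k) xs → ∀ {j} → j < k → j ∈ xs
containing-upTo⁻ upTo∈ j<k = All.lookup upTo∈ (∈-upTo⁺ j<k)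

Wide Narrow : ℕ → Pred (List ℕ) 0ℓ
Wide c   = Containing (upTo c) ∩ ∁ (NarrowBelow c)
Narrow c = Containing (upTo c) ∩ NarrowBelow c

wide? : ∀ c → Decidable (Wide c)
wide? c = containing? (upTo c) ∩? ∁? (narrowBelow? c)

narrow? : ∀ c → Decidable (Narrow c)
narrow? c = containing? (upTo c) ∩? narrowBelow? c

lengthen-embeds : ∀ c → Embeds (lengthen c) (shorten c) (Desc ∩ Wide c) (Desc ∩ Narrow (suc c))
lengthen-embeds c (d , upTo∈ , ¬below) with wideSplit c d ¬below
... | wide {ys} {zs} S rewrite lengthen-wide S =
  (desc-shape (shape-map-suc S′) , containing-upTo⁺ mem , narrow⇒narrowBelow S′) ,
  trans (shorten-narrow S′) (cong (λ ws → ys ++ length ys + c ∷ ws) (delete-insert c (below-desc S)))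
  where
  S′ : DurfeeShape c ys (insert c zs)
  S′ = shape-insert (m≤n+m c (length ys)) S
  mem : ∀ {j} → j < suc c → j ∈ map suc ys ++ insert c zs
  mem (s≤s j≤c) with m≤n⇒m<n∨m≡n j≤c
  ... | inj₁ j<c  = ∈-++⁺ʳ (map suc ys) (∈-insert⁺ c (∈-below-wide S j<c (containing-upTo⁻ upTo∈ j<c)))
  ... | inj₂ refl = ∈-++⁺ʳ (map suc ys) (∈-insert c zs)

shorten-embeds : ∀ c → Embeds (shorten c) (lengthen c) (Desc ∩ Narrow (suc c)) (Desc ∩ Wide c)
shorten-embeds c (d , upTo∈ , below) with narrowSplit c d below
... | narrow {ys} {zs} S rewrite shorten-narrow S =
  (desc-shape (shape-∷ S′) , containing-upTo⁺ mem , wide⇒¬narrowBelow S′) ,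
  trans (lengthen-wide S′) (cong (map suc ys ++_) (insert-delete (below-desc S) (∈zs ≤-refl)))
  where
  S′ : DurfeeShape c ys (delete c zs)
  S′ = shape-delete c S
  ∈zs : ∀ {j} → j < suc c → j ∈ zs
  ∈zs j<1+c = ∈-below (shape-map-suc S) j<1+c (containing-upTo⁻ upTo∈ j<1+c)
  mem : ∀ {j} → j < c → j ∈ ys ++ length ys + c ∷ delete c zs
  mem j<c = ∈-++⁺ʳ ys (there (∈-delete⁺ (∈zs ≤-refl) (<⇒≢ j<c) (∈zs (m<n⇒m<1+n j<c))))

wide≅narrow : ∀ c → Desc ∩ Wide c ≅ Desc ∩ Narrow (suc c)
wide≅narrow c = record
  { to = lengthen c ; from = shorten c ; to-embeds = lengthen-embeds c ; from-embeds = shorten-embeds c }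

SameSize : List ℕ → List ℕ → Set
SameSize xs ys = length xs ≡ length ys × sum xs ≡ sum ys

lengthen-sameSize : ∀ c {xs} → (Desc ∩ Wide c) xs → SameSize (lengthen c xs) xs
lengthen-sameSize c (d , _ , ¬below) with wideSplit c d ¬below
... | wide {ys} {zs} S rewrite lengthen-wide S = length≡ , sum≡
  where
  open ≡-Reasoning
  length≡ : length (map suc ys ++ insert c zs) ≡ length (ys ++ length ys + c ∷ zs)
  length≡ = begin
    length (map suc ys ++ insert c zs)          ≡⟨ List.length-++ (map suc ys) ⟩
    length (map suc ys) + length (insert c zs)  ≡⟨ cong₂ _+_ (List.length-map suc ys) (↭-length (insert-↭ c zs)) ⟩
    length ys + suc (length zs)                 ≡⟨ List.length-++ ys ⟨
    length (ys ++ length ys + c ∷ zs)           ∎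
  sum≡ : sum (map suc ys ++ insert c zs) ≡ sum (ys ++ length ys + c ∷ zs)
  sum≡ = begin
    sum (map suc ys ++ insert c zs)          ≡⟨ sum-++ (map suc ys) (insert c zs) ⟩
    sum (map suc ys) + sum (insert c zs)     ≡⟨ cong₂ _+_ (sum-map-suc ys) (sum-↭ (insert-↭ c zs)) ⟩
    sum ys + length ys + (c + sum zs)        ≡⟨ rearrange (sum ys) (length ys) c (sum zs) ⟩
    sum ys + (length ys + c + sum zs)        ≡⟨ sum-++ ys (length ys + c ∷ zs) ⟨
    sum (ys ++ length ys + c ∷ zs)           ∎
    where
    rearrange : ∀ s l c t → s + l + (c + t) ≡ s + (l + c + t)
    rearrange = solve-∀

durfee-map-suc : ∀ c {xs} → Desc xs → durfee (suc c) (map suc xs) ≡ durfee c xs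
durfee-map-suc c d with durfeeSplit c d
... | split {ys} {zs} S = begin
  durfee (suc c) (map suc (ys ++ zs))       ≡⟨ cong (durfee (suc c)) (List.map-++ suc ys zs) ⟩
  durfee (suc c) (map suc ys ++ map suc zs) ≡⟨ durfee-++ (map suc ys) above≥′ below≤′ ⟩
  length (map suc ys)                       ≡⟨ List.length-map suc ys ⟩
  length ys                                 ≡⟨ durfee-shape S ⟨
  durfee c (ys ++ zs)                       ∎
  where
  open ≡-Reasoning
  above≥′ : All (length (map suc ys) + suc c ≤_) (map suc ys)
  above≥′ = above≥ (shape-map-suc S)
  below≤′ : All (_≤ length (map suc ys) + suc c) (map suc zs)
  below≤′ = subst (λ b → All (_≤ b) (map suc zs)) (sym (width-map-suc c ys))
    (All.map⁺ (All.map s≤s (below≤ S)))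

module _ {c : ℕ} {xs : List ℕ} (d : Desc xs) where

  narrowBelow-map-suc⁺ : NarrowBelow c xs → NarrowBelow (suc c) (map suc xs)
  narrowBelow-map-suc⁺ below rewrite durfee-map-suc c d | List.drop-map {f = suc} (durfee c xs) xs =
    All.map⁺ (All.map (λ z< → ≤-trans (s≤s z<) (≤-reflexive (sym (+-suc (durfee c xs) c)))) below)

  narrowBelow-map-suc⁻ : NarrowBelow (suc c) (map suc xs) → NarrowBelow c xs
  narrowBelow-map-suc⁻ below rewrite durfee-map-suc c d | List.drop-map {f = suc} (durfee c xs) xs =
    All.map (λ z< → ≤-pred (≤-trans z< (≤-reflexive (+-suc (durfee c xs) c)))) (All.map⁻ below)

-- Parts in a residue class

module Residue (a m : ℕ) .{{_ : NonZero m}} (0<a : 0 < a) (a<m : a < m) where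

  part : ℕ → ℕ
  part i = a + m * i

  index : ℕ → ℕ
  index x = (x ∸ a) / m

  indices parts rest : List ℕ → List ℕ
  indices xs = map index (partsCong a m xs)
  parts      = map part
  rest       = partsNotCong a m

  compose : List ℕ → List ℕ → List ℕ
  compose is ns = sort (parts is ++ ns)

  InClass : Pred ℕ 0ℓ
  InClass x = x % m ≡ a % m

  inClass? : Decidable InClass
  inClass? x = x % m ≟ a % m

  index-part : ∀ i → index (part i) ≡ i
  index-part i = begin
    (a + m * i ∸ a) / m ≡⟨ cong (_/ m) (m+n∸m≡n a (m * i)) ⟩
    (m * i) / m         ≡⟨ cong (_/ m) (*-comm m i) ⟩
    (i * m) / m         ≡⟨ m*n/n≡m i m ⟩
    i                   ∎
    where open ≡-Reasoning

  part-injective : ∀ {i j} → part i ≡ part j → i ≡ j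
  part-injective {i} {j} eq = trans (sym (index-part i)) (trans (cong index eq) (index-part j))

  part>0 : ∀ i → 0 < part i
  part>0 i = m≤n⇒m≤n+o (m * i) 0<a

  part-inClass : ∀ i → InClass (part i)
  part-inClass i = trans (cong (λ s → (a + s) % m) (*-comm m i)) ([m+kn]%n≡m%n a i m)

  part-index : ∀ {x} → InClass x → part (index x) ≡ x
  part-index {x} x≡a = begin
    part (index x)              ≡⟨ cong (part ∘ index) x≡part ⟩
    part (index (part (x / m))) ≡⟨ cong part (index-part (x / m)) ⟩
    part (x / m)                ≡⟨ x≡part ⟨
    x                           ∎
    where
    open ≡-Reasoning
    x≡part : x ≡ part (x / m)
    x≡part = trans (m≡m%n+[m/n]*n x m)
      (cong₂ _+_ (trans x≡a (m<n⇒m%n≡m a<m)) (*-comm (x / m) m))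

  parts-indices : ∀ xs → parts (indices xs) ≡ partsCong a m xs
  parts-indices xs = trans (sym (List.map-∘ (partsCong a m xs)))
    (List.map-id-local (All.map part-index (All.all-filter inClass? xs)))

  indices-parts : ∀ is → map index (parts is) ≡ is
  indices-parts is = trans (sym (List.map-∘ is)) (List.map-id-local (All.universal index-part is))

  parts-inClass : ∀ is → All InClass (parts is)
  parts-inClass is = All.map⁺ (All.universal part-inClass is)

  sum-parts : ∀ is → sum (parts is) ≡ a * length is + m * sum is
  sum-parts []       = sym (cong₂ _+_ (*-zeroʳ a) (*-zeroʳ m))
  sum-parts (i ∷ is) = trans (cong (part i +_) (sum-parts is)) (rearrange a m i (length is) (sum is))
    where
    rearrange : ∀ a m i l s → a + m * i + (a * l + m * s) ≡ a * suc l + m * (i + s)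
    rearrange = solve-∀

  desc-partsCong : ∀ {xs} → Desc xs → Desc (partsCong a m xs)
  desc-partsCong = Linked.filter⁺ inClass? ≥-trans

  desc-rest : ∀ {xs} → Desc xs → Desc (rest xs)
  desc-rest = Linked.filter⁺ (∁? inClass?) ≥-trans

  desc-indices : ∀ {xs} → Desc xs → Desc (indices xs)
  desc-indices d = desc-map (/-monoˡ-≤ m ∘ ∸-monoˡ-≤ a) (desc-partsCong d)

  desc-parts : ∀ {is} → Desc is → Desc (parts is)
  desc-parts = desc-map (+-monoʳ-≤ a ∘ *-monoʳ-≤ m)

  partsCong-++-rest-↭ : ∀ xs → partsCong a m xs ++ rest xs ↭ xs
  partsCong-++-rest-↭ xs = ↭-sym (toPermutation (Interleaving.filter⁺ inClass? xs))

  compose-indices-rest : ∀ {xs} → Desc xs → compose (indices xs) (rest xs) ≡ xs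
  compose-indices-rest {xs} d = desc-↭⇒≡ (sort-↗ (parts (indices xs) ++ rest xs)) d (begin
    sort (parts (indices xs) ++ rest xs) ↭⟨ sort-↭ (parts (indices xs) ++ rest xs) ⟩
    parts (indices xs) ++ rest xs        ≡⟨ cong (_++ rest xs) (parts-indices xs) ⟩
    partsCong a m xs ++ rest xs          ↭⟨ partsCong-++-rest-↭ xs ⟩
    xs                                   ∎)
    where open PermutationReasoning

  module _ (is : List ℕ) {ns : List ℕ} (ns∉ : All (∁ InClass) ns) where

    indices-compose : Desc is → indices (compose is ns) ≡ is
    indices-compose is↘ = trans (cong (map index) partsCong-compose) (indices-parts is)
      where
      open PermutationReasoning
      partsCong-compose : partsCong a m (compose is ns) ≡ parts is
      partsCong-compose = desc-↭⇒≡ (desc-partsCong (sort-↗ (parts is ++ ns))) (desc-parts is↘) (begin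
        partsCong a m (compose is ns)            ↭⟨ filter-↭ inClass? (sort-↭ (parts is ++ ns)) ⟩
        partsCong a m (parts is ++ ns)           ≡⟨ List.filter-++ inClass? (parts is) ns ⟩
        partsCong a m (parts is) ++ partsCong a m ns
          ≡⟨ cong₂ _++_ (List.filter-all inClass? (parts-inClass is)) (List.filter-none inClass? ns∉) ⟩
        parts is ++ []                           ≡⟨ List.++-identityʳ (parts is) ⟩
        parts is                                 ∎)

    rest-compose : Desc ns → rest (compose is ns) ≡ ns
    rest-compose ns↘ = desc-↭⇒≡ (desc-rest (sort-↗ (parts is ++ ns))) ns↘ (begin
      rest (compose is ns)        ↭⟨ filter-↭ (∁? inClass?) (sort-↭ (parts is ++ ns)) ⟩
      rest (parts is ++ ns)       ≡⟨ List.filter-++ (∁? inClass?) (parts is) ns ⟩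
      rest (parts is) ++ rest ns
        ≡⟨ cong₂ _++_ (List.filter-none (∁? inClass?) (All.map contradiction (parts-inClass is)))
                      (List.filter-all (∁? inClass?) ns∉) ⟩
      ns                          ∎)
      where open PermutationReasoning

  sum-compose : ∀ is ns → sum (compose is ns) ≡ a * length is + m * sum is + sum ns
  sum-compose is ns = begin
    sum (compose is ns)                      ≡⟨ sum-↭ (sort-↭ (parts is ++ ns)) ⟩
    sum (parts is ++ ns)                     ≡⟨ sum-++ (parts is) ns ⟩
    sum (parts is) + sum ns                  ≡⟨ cong (_+ sum ns) (sum-parts is) ⟩
    a * length is + m * sum is + sum ns      ∎
    where open ≡-Reasoning

  onIndices : (List ℕ → List ℕ) → List ℕ → List ℕ
  onIndices f xs = compose (f (indices xs)) (rest xs)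

  onIndices-partition : ∀ f {n e xs} → SameSize (f (indices xs)) (indices xs) →
    Partition n e xs → Partition n e (onIndices f xs)
  onIndices-partition f {e = e} {xs} (length≡ , sum≡) (d , pos , size) =
    sort-↗ (parts (f (indices xs)) ++ rest xs) ,
    All-resp-↭ (↭-sym (sort-↭ (parts (f (indices xs)) ++ rest xs)))
      (All.++⁺ (All.map⁺ (All.universal part>0 (f (indices xs)))) (All.filter⁺ (∁? inClass?) pos)) ,
    trans (cong (_+ e) sum-onIndices) size
    where
    open ≡-Reasoning
    sum-onIndices : sum (onIndices f xs) ≡ sum xs
    sum-onIndices = begin
      sum (onIndices f xs)
        ≡⟨ sum-compose (f (indices xs)) (rest xs) ⟩
      a * length (f (indices xs)) + m * sum (f (indices xs)) + sum (rest xs)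
        ≡⟨ cong₂ (λ l s → a * l + m * s + sum (rest xs)) length≡ sum≡ ⟩
      a * length (indices xs) + m * sum (indices xs) + sum (rest xs)
        ≡⟨ sum-compose (indices xs) (rest xs) ⟨
      sum (compose (indices xs) (rest xs))
        ≡⟨ cong sum (compose-indices-rest d) ⟩
      sum xs ∎

  onIndices-embeds : ∀ {n e} f g {Q Q′ : Pred (List ℕ) 0ℓ} → Embeds f g (Desc ∩ Q) (Desc ∩ Q′) →
    (∀ {is} → (Desc ∩ Q) is → SameSize (f is) is) →
    Embeds (onIndices f) (onIndices g) (Partition n e ∩ Q ∘ indices) (Partition n e ∩ Q′ ∘ indices)
  onIndices-embeds f g {Q′ = Q′} embeds sameSize {xs} (P@(d , _) , q) with embeds (desc-indices d , q)
  ... | (f↘ , q′) , g∘f =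
    (onIndices-partition f (sameSize (desc-indices d , q)) P , subst Q′ (sym indices≡) q′) , (begin
    compose (g (indices (onIndices f xs))) (rest (onIndices f xs))
      ≡⟨ cong₂ compose (trans (cong g indices≡) g∘f) (rest-compose (f (indices xs)) rest∉ (desc-rest d)) ⟩
    compose (indices xs) (rest xs)
      ≡⟨ compose-indices-rest d ⟩
    xs ∎)
    where
    open ≡-Reasoning
    rest∉ : All (∁ InClass) (rest xs)
    rest∉ = All.all-filter (∁? inClass?) xs
    indices≡ : indices (onIndices f xs) ≡ f (indices xs)
    indices≡ = indices-compose (f (indices xs)) rest∉ f↘

  #-indices-≅ : ∀ n e {Q Q′ : Pred (List ℕ) 0ℓ} (Q? : Decidable Q) (Q′? : Decidable Q′)
    (Q≅Q′ : Desc ∩ Q ≅ Desc ∩ Q′) →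
    (∀ {is} → (Desc ∩ Q) is → SameSize (_≅_.to Q≅Q′ is) is) →
    #[ n - e ] (Q? ∘ indices) ≡ #[ n - e ] (Q′? ∘ indices)
  #-indices-≅ n e {Q} {Q′} Q? Q′? Q≅Q′ sameSize = #-≅ n e (Q? ∘ indices) (Q′? ∘ indices) record
    { to = onIndices to
    ; from = onIndices from
    ; to-embeds = onIndices-embeds to from {Q} {Q′} to-embeds sameSize
    ; from-embeds = onIndices-embeds from to {Q′} {Q} from-embeds from-sameSize
    }
    where
    open _≅_ Q≅Q′
    from-sameSize : ∀ {is} → (Desc ∩ Q′) is → SameSize (from is) is
    from-sameSize q′ with from-embeds q′
    ... | q , to∘from = let length≡ , sum≡ = sameSize q in
      trans (sym length≡) (cong length to∘from) , trans (sym sum≡) (cong sum to∘from)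

  firstParts : ℕ → List ℕ
  firstParts k = parts (upTo k)

  firstParts-unique : ∀ k → Unique (firstParts k)
  firstParts-unique k = Unique.map⁺ part-injective (Unique.upTo⁺ k)

  firstParts>0 : ∀ k → All (0 <_) (firstParts k)
  firstParts>0 k = All.map⁺ (All.universal part>0 (upTo k))

  sum-firstParts-suc : ∀ k → sum (firstParts (suc k)) ≡ sum (firstParts k) + part k
  sum-firstParts-suc k = begin
    sum (parts (upTo (suc k)))         ≡⟨ cong (sum ∘ parts) (List.upTo-∷ʳ k) ⟨
    sum (parts (upTo k ++ [ k ]))      ≡⟨ cong sum (List.map-++ part (upTo k) [ k ]) ⟩
    sum (firstParts k ++ [ part k ])   ≡⟨ sum-++ (firstParts k) [ part k ] ⟩
    sum (firstParts k) + (part k + 0)  ≡⟨ cong (sum (firstParts k) +_) (+-identityʳ (part k)) ⟩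
    sum (firstParts k) + part k        ∎
    where open ≡-Reasoning

  sum-firstParts : ∀ k → sum (firstParts k) * 2 + m * k ≡ k * (2 * a + m * k)
  sum-firstParts zero    = *-zeroʳ m
  sum-firstParts (suc k) = begin
    sum (firstParts (suc k)) * 2 + m * suc k
      ≡⟨ cong (λ w → w * 2 + m * suc k) (sum-firstParts-suc k) ⟩
    (sum (firstParts k) + part k) * 2 + m * suc k
      ≡⟨ rearrange (sum (firstParts k)) a m k ⟩
    sum (firstParts k) * 2 + m * k + (2 * a + m * k * 2 + m)
      ≡⟨ cong (_+ (2 * a + m * k * 2 + m)) (sum-firstParts k) ⟩
    k * (2 * a + m * k) + (2 * a + m * k * 2 + m)
      ≡⟨ expand a m k ⟨
    suc k * (2 * a + m * suc k) ∎
    where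
    open ≡-Reasoning
    rearrange : ∀ w a m k → (w + (a + m * k)) * 2 + m * suc k ≡ w * 2 + m * k + (2 * a + m * k * 2 + m)
    rearrange = solve-∀
    expand : ∀ a m k → suc k * (2 * a + m * suc k) ≡ k * (2 * a + m * k) + (2 * a + m * k * 2 + m)
    expand = solve-∀

  ≤-sum-firstParts : ∀ k → k ≤ sum (firstParts k)
  ≤-sum-firstParts k = begin
    k                     ≡⟨ List.length-upTo k ⟨
    length (upTo k)       ≡⟨ List.length-map part (upTo k) ⟨
    length (firstParts k) ≤⟨ length≤sum (firstParts>0 k) ⟩
    sum (firstParts k)    ∎
    where open ≤-Reasoning

  ∈-indices⁺ : ∀ {j xs} → part j ∈ xs → j ∈ indices xs
  ∈-indices⁺ {j} part∈ = subst (_∈ _) (index-part j)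
    (∈-map⁺ index (∈-filter⁺ inClass? part∈ (part-inClass j)))

  ∈-indices⁻ : ∀ {j xs} → j ∈ indices xs → part j ∈ partsCong a m xs
  ∈-indices⁻ {xs = xs} j∈ = subst (part _ ∈_) (parts-indices xs) (∈-map⁺ part j∈)

  #-containing-indices : ∀ n k →
    #[ n - 0 ] (containing? (upTo k) ∘ indices) ≡ p[ n - sum (firstParts k) ]
  #-containing-indices n k = begin
    #[ n - 0 ] (containing? (upTo k) ∘ indices)
      ≡⟨ #-cong n 0 (containing? (upTo k) ∘ indices) (containing? (firstParts k))
           (λ {xs} _ → All.map⁺ ∘ All.map (proj₁ ∘ ∈-filter⁻ inClass? {xs = xs} ∘ ∈-indices⁻ {xs = xs}))
           (λ _ → All.map ∈-indices⁺ ∘ All.map⁻) ⟩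
    #[ n - 0 ] (containing? (firstParts k)) ≡⟨ #-containing 0 (firstParts>0 k) (firstParts-unique k) ⟩
    p[ n - sum (firstParts k) + 0 ]         ≡⟨ cong p[ n -_] (+-identityʳ (sum (firstParts k))) ⟩
    p[ n - sum (firstParts k) ]             ∎
    where open ≡-Reasoning

  #-narrow-recurrence : ∀ n k →
    #[ n - 0 ] (narrow? k ∘ indices) + #[ n - 0 ] (narrow? (suc k) ∘ indices) ≡ p[ n - sum (firstParts k) ]
  #-narrow-recurrence n k = begin
    #[ n - 0 ] (narrow? k ∘ indices) + #[ n - 0 ] (narrow? (suc k) ∘ indices)
      ≡⟨ cong (#[ n - 0 ] (narrow? k ∘ indices) +_)
           (#-indices-≅ n 0 (wide? k) (narrow? (suc k)) (wide≅narrow k) (lengthen-sameSize k)) ⟨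
    #[ n - 0 ] (narrow? k ∘ indices) + #[ n - 0 ] (wide? k ∘ indices)
      ≡⟨ #-∩-∁ n 0 (containing? (upTo k) ∘ indices) (narrowBelow? k ∘ indices) ⟨
    #[ n - 0 ] (containing? (upTo k) ∘ indices)
      ≡⟨ #-containing-indices n k ⟩
    p[ n - sum (firstParts k) ] ∎
    where open ≡-Reasoning

  rowLengths-partsCong : ∀ xs → rowLengths a m (partsCong a m xs) ≡ map suc (indices xs)
  rowLengths-partsCong xs = trans (List.map-cong (λ x → +-comm (index x) 1) (partsCong a m xs))
    (List.map-∘ (partsCong a m xs))

  module _ (ν : ℕ) {xs : List ℕ} (d : Desc xs) where

    private
      ls : List ℕ
      ls = rowLengths a m (partsCong a m xs)
      BelowDurfee : Set
      BelowDurfee = All (_< durfeeHeight ν ls + ν + 2) (drop (durfeeHeight ν ls) ls)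

    belowDurfee≡narrowBelow : BelowDurfee ≡ NarrowBelow (2 + ν) (map suc (indices xs))
    belowDurfee≡narrowBelow rewrite rowLengths-partsCong xs | +-comm ν 2 =
      cong (λ b → All (_< b) (drop t is)) (trans (+-assoc t ν 2) (cong (t +_) (+-comm ν 2)))
      where
      is : List ℕ
      is = map suc (indices xs)
      t : ℕ
      t = durfee (2 + ν) is

    mCond⇒narrow : MCond a m ν (partsCong a m xs) → Narrow (suc ν) (indices xs)
    mCond⇒narrow (parts∈ , below) =
      All.map (∈-indices⁺ ∘ proj₁ ∘ ∈-filter⁻ inClass? {xs = xs}) parts∈ ,
      narrowBelow-map-suc⁻ (desc-indices d) (subst id belowDurfee≡narrowBelow below)

    narrow⇒mCond : Narrow (suc ν) (indices xs) → MCond a m ν (partsCong a m xs)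
    narrow⇒mCond (upTo∈ , below) =
      All.map (∈-indices⁻ {xs = xs}) upTo∈ ,
      subst id (sym belowDurfee≡narrowBelow) (narrowBelow-map-suc⁺ (desc-indices d) below)

  sum-partsCong : ∀ {n} xs → sum xs ≡ n → sum (partsCong a m xs) ≡ n ∸ sum (rest xs)
  sum-partsCong xs refl = begin
    sum (partsCong a m xs)
      ≡⟨ m+n∸n≡m (sum (partsCong a m xs)) (sum (rest xs)) ⟨
    sum (partsCong a m xs) + sum (rest xs) ∸ sum (rest xs)
      ≡⟨ cong (_∸ sum (rest xs)) (sum-++ (partsCong a m xs) (rest xs)) ⟨
    sum (partsCong a m xs ++ rest xs) ∸ sum (rest xs)
      ≡⟨ cong (_∸ sum (rest xs)) (sum-↭ (partsCong-++-rest-↭ xs)) ⟩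
    sum xs ∸ sum (rest xs) ∎
    where open ≡-Reasoning

  pν≡#narrow : ∀ ν n → pν a m ν n ≡ #[ n - 0 ] (narrow? (suc ν) ∘ indices)
  pν≡#narrow ν n = count-≐ (λ xs → isPartition? n xs ×-dec PCond? a m ν n xs)
    (partition? n 0 ∩? narrow? (suc ν) ∘ indices)
    ( (λ {xs} ((d , pos , sum≡) , (_ , _ , mCond)) →
         (d , pos , trans (+-identityʳ (sum xs)) sum≡) , mCond⇒narrow ν d mCond)
    , (λ {xs} ((d , pos , sum+0≡) , is-narrow) →
         let sum≡ = trans (sym (+-identityʳ (sum xs))) sum+0≡ in
         (d , pos , sum≡) ,
         (desc-partsCong d , All.filter⁺ inClass? pos , sum-partsCong xs sum≡) ,
         All.all-filter inClass? xs ,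
         narrow⇒mCond ν d is-narrow))
    (candidates n)

  pν-recurrence : ∀ n ν → pν a m ν n + pν a m (suc ν) n ≡ p[ n - sum (firstParts (suc ν)) ]
  pν-recurrence n ν = trans (cong₂ _+_ (pν≡#narrow ν n) (pν≡#narrow (suc ν) n))
    (#-narrow-recurrence n (suc ν))

-- First columns and first rows

addColumn : ℕ → List ℕ → List ℕ
addColumn h r = map suc r ++ replicate (h ∸ length r) 1

dropColumn : List ℕ → List ℕ
dropColumn xs = filter (0 <?_) (map pred xs)

filter-positive-≤0 : ∀ {xs} → All (_≤ 0) xs → filter (0 <?_) xs ≡ []
filter-positive-≤0 xs≤0 = List.filter-none (0 <?_) (All.map ≤⇒≯ xs≤0)

sum-replicate-1 : ∀ k → sum (replicate k 1) ≡ k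
sum-replicate-1 zero    = refl
sum-replicate-1 (suc k) = cong suc (sum-replicate-1 k)

module _ (h : ℕ) (r : List ℕ) where

  private
    ones : List ℕ
    ones = replicate (h ∸ length r) 1

  addColumn-desc : Desc r → Desc (addColumn h r)
  addColumn-desc r↘ = desc-++ (desc-map s≤s r↘) (ones-desc (h ∸ length r))
    (All.map⁺ (All.universal (λ _ → s≤s z≤n) r)) (All.replicate⁺ (h ∸ length r) ≤-refl)
    where
    ones-desc : ∀ k → Desc (replicate k 1)
    ones-desc zero    = []
    ones-desc (suc k) = desc-∷ (All.replicate⁺ k ≤-refl) (ones-desc k)

  addColumn>0 : All (0 <_) (addColumn h r)
  addColumn>0 = All.++⁺ (All.map⁺ (All.universal (λ _ → z<s) r)) (All.replicate⁺ (h ∸ length r) z<s)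

  addColumn-≤ : ∀ {b} → All (_≤ b) r → All (_≤ suc b) (addColumn h r)
  addColumn-≤ r≤b = All.++⁺ (All.map⁺ (All.map s≤s r≤b)) (All.replicate⁺ (h ∸ length r) (s≤s z≤n))

  length-addColumn : length r ≤ h → length (addColumn h r) ≡ h
  length-addColumn |r|≤h = begin
    length (map suc r ++ ones)       ≡⟨ List.length-++ (map suc r) ⟩
    length (map suc r) + length ones ≡⟨ cong₂ _+_ (List.length-map suc r) (List.length-replicate (h ∸ length r)) ⟩
    length r + (h ∸ length r)        ≡⟨ m+[n∸m]≡n |r|≤h ⟩
    h                                ∎
    where open ≡-Reasoning

  sum-addColumn : length r ≤ h → sum (addColumn h r) ≡ h + sum r
  sum-addColumn |r|≤h = begin
    sum (map suc r ++ ones)             ≡⟨ sum-++ (map suc r) ones ⟩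
    sum (map suc r) + sum ones          ≡⟨ cong₂ _+_ (sum-map-suc r) (sum-replicate-1 (h ∸ length r)) ⟩
    sum r + length r + (h ∸ length r)   ≡⟨ +-assoc (sum r) (length r) (h ∸ length r) ⟩
    sum r + (length r + (h ∸ length r)) ≡⟨ cong (sum r +_) (m+[n∸m]≡n |r|≤h) ⟩
    sum r + h                           ≡⟨ +-comm (sum r) h ⟩
    h + sum r                           ∎
    where open ≡-Reasoning

  dropColumn-addColumn : All (0 <_) r → dropColumn (addColumn h r) ≡ r
  dropColumn-addColumn r>0 = begin
    filter (0 <?_) (map pred (map suc r ++ ones))
      ≡⟨ cong (filter (0 <?_)) (List.map-++ pred (map suc r) ones) ⟩
    filter (0 <?_) (map pred (map suc r) ++ map pred ones)
      ≡⟨ List.filter-++ (0 <?_) (map pred (map suc r)) (map pred ones) ⟩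
    filter (0 <?_) (map pred (map suc r)) ++ filter (0 <?_) (map pred ones)
      ≡⟨ cong₂ _++_ (trans (cong (filter (0 <?_)) (map-pred-suc r)) (List.filter-all (0 <?_) r>0))
                    (filter-positive-≤0 (All.map⁺ {f = pred} (All.replicate⁺ (h ∸ length r) z≤n))) ⟩
    r ++ []
      ≡⟨ List.++-identityʳ r ⟩
    r ∎
    where open ≡-Reasoning

dropColumn-desc : ∀ {xs} → Desc xs → Desc (dropColumn xs)
dropColumn-desc xs↘ = Linked.filter⁺ (0 <?_) ≥-trans (desc-map pred-mono-≤ xs↘)

dropColumn>0 : ∀ xs → All (0 <_) (dropColumn xs)
dropColumn>0 xs = All.all-filter (0 <?_) (map pred xs)

dropColumn-≤ : ∀ {b xs} → All (_≤ suc b) xs → All (_≤ b) (dropColumn xs)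
dropColumn-≤ xs≤ = All.filter⁺ (0 <?_) (All.map⁺ (All.map pred-mono-≤ xs≤))

length-dropColumn-≤ : ∀ xs → length (dropColumn xs) ≤ length xs
length-dropColumn-≤ xs = ≤-trans (List.length-filter (0 <?_) (map pred xs))
  (≤-reflexive (List.length-map pred xs))

addColumn-dropColumn : ∀ {xs} → Desc xs → All (0 <_) xs → addColumn (length xs) (dropColumn xs) ≡ xs
addColumn-dropColumn {[]}               d []        = refl
addColumn-dropColumn {suc (suc x) ∷ xs} d (_ ∷ pos) =
  cong (suc (suc x) ∷_) (addColumn-dropColumn (Linked.tail d) pos)
addColumn-dropColumn {suc zero ∷ xs}    d (_ ∷ pos)
  with dropColumn xs | filter-positive-≤0 (All.map⁺ {f = pred} (All.map pred-mono-≤ (desc-head d)))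
     | addColumn-dropColumn (Linked.tail d) pos
... | .[] | refl | ones≡xs = cong (1 ∷_) ones≡xs

sum-dropColumn : ∀ {xs} → Desc xs → All (0 <_) xs → length xs + sum (dropColumn xs) ≡ sum xs
sum-dropColumn {xs} d pos = begin
  length xs + sum (dropColumn xs)             ≡⟨ sum-addColumn (length xs) (dropColumn xs) (length-dropColumn-≤ xs) ⟨
  sum (addColumn (length xs) (dropColumn xs)) ≡⟨ cong sum (addColumn-dropColumn d pos) ⟩
  sum xs                                      ∎
  where open ≡-Reasoning

firstRow : List ℕ → ℕ
firstRow xs = at xs 0

addRow : ℕ → List ℕ → List ℕ
addRow zero    r = r
addRow (suc h) r = suc h ∷ r

addRow-desc : ∀ {r} h → All (_≤ h) r → Desc r → Desc (addRow h r)
addRow-desc zero    r≤ r↘ = r↘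
addRow-desc (suc h) r≤ r↘ = desc-∷ r≤ r↘

addRow>0 : ∀ {r} h → All (0 <_) r → All (0 <_) (addRow h r)
addRow>0 zero    r>0 = r>0
addRow>0 (suc h) r>0 = z<s ∷ r>0

sum-addRow : ∀ h r → sum (addRow h r) ≡ h + sum r
sum-addRow zero    r = refl
sum-addRow (suc h) r = refl

length-addRow-≤ : ∀ h r → length (addRow h r) ≤ suc (length r)
length-addRow-≤ zero    r = n≤1+n (length r)
length-addRow-≤ (suc h) r = ≤-refl

firstRow-addRow : ∀ {r} h → All (_≤ h) r → firstRow (addRow h r) ≡ h
firstRow-addRow zero    r≤ = n≤0⇒n≡0 (at-≤ 0 r≤)
firstRow-addRow (suc h) r≤ = refl

tail-addRow : ∀ {r} h → All (_≤ h) r → All (0 <_) r → drop 1 (addRow h r) ≡ r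
tail-addRow zero    []        []        = refl
tail-addRow zero    (x≤0 ∷ _) (x>0 ∷ _) = contradiction x≤0 (<⇒≱ x>0)
tail-addRow (suc h) _         _         = refl

addRow-tail : ∀ {xs} → All (0 <_) xs → addRow (firstRow xs) (drop 1 xs) ≡ xs
addRow-tail []        = refl
addRow-tail (z<s ∷ _) = refl

tail-desc : ∀ {xs} → Desc xs → Desc (drop 1 xs)
tail-desc {[]}    d = []
tail-desc {_ ∷ _} d = Linked.tail d

≤-firstRow : ∀ {xs} → Desc xs → All (_≤ firstRow xs) xs
≤-firstRow {[]}    d = []
≤-firstRow {x ∷ _} d = ≤-refl ∷ desc-head d

-- Dyson's rank, the largest part minus the number of parts, is at most u − v.
Rank≤ : (u v : ℕ) → Pred (List ℕ) 0ℓ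
Rank≤ u v xs = firstRow xs + v ≤ length xs + u

rank≤? : ∀ u v → Decidable (Rank≤ u v)
rank≤? u v xs = firstRow xs + v ≤? length xs + u

#-rank≤-cancel : ∀ n e u v d → #[ n - e ] (rank≤? (d + u) (d + v)) ≡ #[ n - e ] (rank≤? u v)
#-rank≤-cancel n e u v d = #-cong n e (rank≤? (d + u) (d + v)) (rank≤? u v)
  (λ {xs} _ rank → +-cancelˡ-≤ d _ _ (subst id (shift xs) rank))
  (λ {xs} _ rank → subst id (sym (shift xs)) (+-monoʳ-≤ d rank))
  where
  +-shift : ∀ x d v → x + (d + v) ≡ d + (x + v)
  +-shift = solve-∀
  shift : ∀ xs → Rank≤ (d + u) (d + v) xs ≡ (d + (firstRow xs + v) ≤ d + (length xs + u))
  shift xs = cong₂ _≤_ (+-shift (firstRow xs) d v) (+-shift (length xs) d u)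

-- The bijection exchanges the first column, of height t, for a first row of length
-- t + 3j − 1, where the integer 3j is represented as u − v.
module BressoudZeilberger (u v : ℕ) where

  columnToRow : List ℕ → List ℕ
  columnToRow xs = addRow (length xs + u ∸ suc v) (dropColumn xs)

  rowToColumn : List ℕ → List ℕ
  rowToColumn ys = addColumn (firstRow ys + suc v ∸ u) (drop 1 ys)

  record Exchangeable (t h : ℕ) (r : List ℕ) : Set where
    field
      balanced : t + u ≡ h + suc v
      length≤  : length r ≤ t
      parts≤   : All (_≤ h) r

  open Exchangeable

  module _ {t h : ℕ} {r : List ℕ} (E : Exchangeable t h r) where

    rowLength⇒columnHeight : h + suc v ∸ u ≡ t
    rowLength⇒columnHeight = trans (cong (_∸ u) (sym (balanced E))) (m+n∸n≡m t u)

    columnHeight⇒rowLength : t + u ∸ suc v ≡ h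
    columnHeight⇒rowLength = trans (cong (_∸ suc v) (balanced E)) (m+n∸n≡m h (suc v))

    columnToRow-addColumn : All (0 <_) r → columnToRow (addColumn t r) ≡ addRow h r
    columnToRow-addColumn r>0 = begin
      addRow (length (addColumn t r) + u ∸ suc v) (dropColumn (addColumn t r))
        ≡⟨ cong₂ (λ l s → addRow (l + u ∸ suc v) s)
             (length-addColumn t r (length≤ E)) (dropColumn-addColumn t r r>0) ⟩
      addRow (t + u ∸ suc v) r
        ≡⟨ cong (λ x → addRow x r) columnHeight⇒rowLength ⟩
      addRow h r ∎
      where open ≡-Reasoning

    rowToColumn-addRow : All (0 <_) r → rowToColumn (addRow h r) ≡ addColumn t r
    rowToColumn-addRow r>0 = begin
      addColumn (firstRow (addRow h r) + suc v ∸ u) (drop 1 (addRow h r))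
        ≡⟨ cong₂ (λ x s → addColumn (x + suc v ∸ u) s)
             (firstRow-addRow h (parts≤ E)) (tail-addRow h (parts≤ E) r>0) ⟩
      addColumn (h + suc v ∸ u) r
        ≡⟨ cong (λ x → addColumn x r) rowLength⇒columnHeight ⟩
      addColumn t r ∎
      where open ≡-Reasoning

    rank≤-addColumn : Rank≤ u v (addColumn t r)
    rank≤-addColumn = begin
      firstRow (addColumn t r) + v  ≤⟨ +-monoˡ-≤ v (at-≤ 0 (addColumn-≤ t r (parts≤ E))) ⟩
      suc h + v                     ≡⟨ +-suc h v ⟨
      h + suc v                     ≡⟨ balanced E ⟨
      t + u                         ≡⟨ cong (_+ u) (length-addColumn t r (length≤ E)) ⟨
      length (addColumn t r) + u    ∎
      where open ≤-Reasoning

    rank≰-addRow : ¬ Rank≤ u (3 + v) (addRow h r)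
    rank≰-addRow = <⇒≱ (begin-strict
      length (addRow h r) + u          ≤⟨ +-monoˡ-≤ u (≤-trans (length-addRow-≤ h r) (s≤s (length≤ E))) ⟩
      suc (t + u)                      ≡⟨ cong suc (balanced E) ⟩
      suc (h + suc v)                  ≡⟨ +-suc h (suc v) ⟨
      h + (2 + v)                      <⟨ +-monoʳ-< h (n<1+n (2 + v)) ⟩
      h + (3 + v)                      ≡⟨ cong (_+ (3 + v)) (firstRow-addRow h (parts≤ E)) ⟨
      firstRow (addRow h r) + (3 + v)  ∎)
      where open ≤-Reasoning

  exchangeable-column : ∀ {xs} → Desc xs → v < length xs + u → Rank≤ u v xs →
    Exchangeable (length xs) (length xs + u ∸ suc v) (dropColumn xs)
  exchangeable-column {xs} d v<length+u rank = record
    { balanced = sym h+1+v≡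
    ; length≤  = length-dropColumn-≤ xs
    ; parts≤   = dropColumn-≤ (All.map (flip ≤-trans firstRow≤) (≤-firstRow d))
    }
    where
    h : ℕ
    h = length xs + u ∸ suc v
    h+1+v≡ : h + suc v ≡ length xs + u
    h+1+v≡ = m∸n+n≡m v<length+u
    firstRow≤ : firstRow xs ≤ suc h
    firstRow≤ = +-cancelʳ-≤ v _ _ (≤-trans rank (≤-reflexive (trans (sym h+1+v≡) (+-suc h v))))

  exchangeable-row : ∀ {ys} → Desc ys → length (drop 1 ys) + u ≤ firstRow ys + suc v →
    Exchangeable (firstRow ys + suc v ∸ u) (firstRow ys) (drop 1 ys)
  exchangeable-row {ys} d length+u≤ = record
    { balanced = m∸n+n≡m (m+n≤o⇒n≤o (length (drop 1 ys)) length+u≤)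
    ; length≤  = m+n≤o⇒m≤o∸n (length (drop 1 ys)) length+u≤
    ; parts≤   = All.drop⁺ 1 (≤-firstRow d)
    }

  module _ {n e e′ : ℕ} (balance : u + e′ ≡ suc v + e) where

    exchange-size : ∀ {t h} s → t + u ≡ h + suc v → t + s + e ≡ h + s + e′
    exchange-size {t} {h} s t+u≡h+1+v = +-cancelʳ-≡ (u + suc v) _ _ (begin
      t + s + e + (u + suc v)       ≡⟨ rearrange t s e u (suc v) ⟩
      t + u + (suc v + e) + s       ≡⟨ cong₂ (λ x y → x + y + s) t+u≡h+1+v (sym balance) ⟩
      h + suc v + (u + e′) + s      ≡⟨ rearrange h s e′ (suc v) u ⟨
      h + s + e′ + (suc v + u)      ≡⟨ cong (h + s + e′ +_) (+-comm (suc v) u) ⟩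
      h + s + e′ + (u + suc v)      ∎)
      where
      open ≡-Reasoning
      rearrange : ∀ t s e u v → t + s + e + (u + v) ≡ t + u + (v + e) + s
      rearrange = solve-∀

    columnToRow-embeds : (v ≡ u → e ≢ n) →
      Embeds columnToRow rowToColumn (Partition n e ∩ Rank≤ u v) (Partition n e′ ∩ ∁ (Rank≤ u (3 + v)))
    columnToRow-embeds v≡u⇒e≢n {xs} ((d , pos , size) , rank) =
      ((addRow-desc h (parts≤ E) (dropColumn-desc d) , addRow>0 h (dropColumn>0 xs) , size′) ,
       rank≰-addRow E) ,
      trans (rowToColumn-addRow E (dropColumn>0 xs)) (addColumn-dropColumn d pos)
      where
      h : ℕ
      h = length xs + u ∸ suc v

      v<length+u : ∀ {xs} → All (0 <_) xs → sum xs + e ≡ n → Rank≤ u v xs → v < length xs + u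
      v<length+u []          e≡n rank = ≤∧≢⇒< rank (λ v≡u → v≡u⇒e≢n v≡u e≡n)
      v<length+u (x>0 ∷ pos) _   rank = ≤-trans (+-monoˡ-≤ v x>0) rank

      E : Exchangeable (length xs) h (dropColumn xs)
      E = exchangeable-column d (v<length+u pos size rank) rank

      size′ : sum (addRow h (dropColumn xs)) + e′ ≡ n
      size′ = begin
        sum (addRow h (dropColumn xs)) + e′  ≡⟨ cong (_+ e′) (sum-addRow h (dropColumn xs)) ⟩
        h + sum (dropColumn xs) + e′         ≡⟨ exchange-size (sum (dropColumn xs)) (balanced E) ⟨
        length xs + sum (dropColumn xs) + e  ≡⟨ cong (_+ e) (sum-dropColumn d pos) ⟩
        sum xs + e                           ≡⟨ size ⟩
        n                                    ∎
        where open ≡-Reasoning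

    rowToColumn-embeds : u ≢ 2 + v →
      Embeds rowToColumn columnToRow (Partition n e′ ∩ ∁ (Rank≤ u (3 + v))) (Partition n e ∩ Rank≤ u v)
    rowToColumn-embeds u≢2+v {ys} ((d , pos , size) , rank≰) =
      ((addColumn-desc t r (tail-desc d) , addColumn>0 t r , size′) , rank≤-addColumn E) ,
      trans (columnToRow-addColumn E (All.drop⁺ 1 pos)) (addRow-tail pos)
      where
      h t : ℕ
      h = firstRow ys
      t = h + suc v ∸ u

      r : List ℕ
      r = drop 1 ys

      length+u≤ : ∀ ys → length ys + u < firstRow ys + (3 + v) →
        length (drop 1 ys) + u ≤ firstRow ys + suc v
      length+u≤ []       (s≤s u≤2+v) = ≤-pred (≤∧≢⇒< u≤2+v u≢2+v)
      length+u≤ (y ∷ ys) rank        = ≤-pred (≤-pred (≤-trans rank (≤-reflexive (shift y v))))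
        where
        shift : ∀ y v → y + (3 + v) ≡ 2 + (y + suc v)
        shift = solve-∀

      E : Exchangeable t h r
      E = exchangeable-row d (length+u≤ ys (≰⇒> rank≰))

      size′ : sum (addColumn t r) + e ≡ n
      size′ = begin
        sum (addColumn t r) + e  ≡⟨ cong (_+ e) (sum-addColumn t r (length≤ E)) ⟩
        t + sum r + e            ≡⟨ exchange-size (sum r) (balanced E) ⟩
        h + sum r + e′           ≡⟨ cong (_+ e′) (sum-addRow h r) ⟨
        sum (addRow h r) + e′    ≡⟨ cong (λ zs → sum zs + e′) (addRow-tail pos) ⟩
        sum ys + e′              ≡⟨ size ⟩
        n                        ∎
        where open ≡-Reasoning

    #-rank≤-recurrence : (v ≡ u → e ≢ n) → u ≢ 2 + v →
      #[ n - e ] (rank≤? u v) + #[ n - e′ ] (rank≤? u (3 + v)) ≡ p[ n - e′ ]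
    #-rank≤-recurrence v≡u⇒e≢n u≢2+v = begin
      #[ n - e ] (rank≤? u v) + #[ n - e′ ] (rank≤? u (3 + v))
        ≡⟨ cong (_+ #[ n - e′ ] (rank≤? u (3 + v)))
             (#-≅ n e (rank≤? u v) (∁? (rank≤? u (3 + v))) exchange) ⟩
      #[ n - e′ ] (∁? (rank≤? u (3 + v))) + #[ n - e′ ] (rank≤? u (3 + v))
        ≡⟨ +-comm _ (#[ n - e′ ] (rank≤? u (3 + v))) ⟩
      #[ n - e′ ] (rank≤? u (3 + v)) + #[ n - e′ ] (∁? (rank≤? u (3 + v)))
        ≡⟨ #-∁ n e′ (rank≤? u (3 + v)) ⟨
      p[ n - e′ ] ∎
      where
      open ≡-Reasoning
      exchange : Partition n e ∩ Rank≤ u v ≅ Partition n e′ ∩ ∁ (Rank≤ u (3 + v))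
      exchange = record
        { to          = columnToRow
        ; from        = rowToColumn
        ; to-embeds   = columnToRow-embeds v≡u⇒e≢n
        ; from-embeds = rowToColumn-embeds u≢2+v
        }

open BressoudZeilberger

-- The two families of recurrences

alternating-recurrence-unique : ∀ {X Y F : ℕ → ℕ} b → (∀ k → X k + X (suc k) ≡ F k) →
  (∀ k → Y k + Y (suc k) ≡ F k) → (∀ k → b ≤ k → F k ≡ 0) → ∀ k → X k ≡ Y k
alternating-recurrence-unique {X} {Y} {F} b recX recY F≡0 k = descend b k (m≤m+n b k)
  where
  descend : ∀ d k → b ≤ d + k → X k ≡ Y k
  descend zero    k b≤k = trans (m+n≡0⇒m≡0 (X k) (trans (recX k) (F≡0 k b≤k)))
                           (sym (m+n≡0⇒m≡0 (Y k) (trans (recY k) (F≡0 k b≤k))))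
  descend (suc d) k b≤  = +-cancelʳ-≡ (X (suc k)) (X k) (Y k) (begin
    X k + X (suc k) ≡⟨ recX k ⟩
    F k             ≡⟨ recY k ⟨
    Y k + Y (suc k) ≡⟨ cong (Y k +_) (descend d (suc k) (subst (b ≤_) (sym (+-suc d k)) b≤)) ⟨
    Y k + X (suc k) ∎)
    where open ≡-Reasoning

module Residue₁ = Residue 1 3 z<s (s<s z<s)
module Residue₂ = Residue 2 3 z<s (s<s (s<s z<s))

weight₁ weight₂ : ℕ → ℕ
weight₁ k = sum (Residue₁.firstParts k)
weight₂ k = sum (Residue₂.firstParts k)

m*2≡n⇒n/2≡m : ∀ {m n} → m * 2 ≡ n → n / 2 ≡ m
m*2≡n⇒n/2≡m {m} refl = m*n/n≡m m 2

weight₂-formula : ∀ k → k * (3 * k + 1) / 2 ≡ weight₂ k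
weight₂-formula k = m*2≡n⇒n/2≡m weight*2
  where
  rearrange : ∀ k → k * (4 + 3 * k) ≡ k * (3 * k + 1) + 3 * k
  rearrange = solve-∀
  weight*2 : weight₂ k * 2 ≡ k * (3 * k + 1)
  weight*2 = +-cancelʳ-≡ (3 * k) _ _ (trans (Residue₂.sum-firstParts k) (rearrange k))

weight₁-formula : ∀ k → suc (k * (3 * k + 5) / 2) ≡ weight₁ (suc k)
weight₁-formula k = begin
  suc (k * (3 * k + 5) / 2) ≡⟨ m/n≡1+[m∸n]/n {2 + k * (3 * k + 5)} {2} (s≤s (s≤s z≤n)) ⟨
  (2 + k * (3 * k + 5)) / 2 ≡⟨ m*2≡n⇒n/2≡m weight*2 ⟩
  weight₁ (suc k)           ∎
  where
  open ≡-Reasoning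
  rearrange : ∀ k → suc k * (2 + 3 * suc k) ≡ 2 + k * (3 * k + 5) + 3 * suc k
  rearrange = solve-∀
  weight*2 : weight₁ (suc k) * 2 ≡ 2 + k * (3 * k + 5)
  weight*2 = +-cancelʳ-≡ (3 * suc k) _ _ (trans (Residue₁.sum-firstParts (suc k)) (rearrange k))

-- The numbers A_{−k} and A_k.
A₋ A₊ : ℕ → ℕ → ℕ
A₋ n k = #[ n - weight₁ k ] (rank≤? 0 (k * 3))
A₊ n k = #[ n - weight₂ k ] (rank≤? (k * 3) 0)

A₋-recurrence : ∀ {n} → 0 < n → ∀ k → A₋ n k + A₋ n (suc k) ≡ p[ n - weight₁ (suc k) ]
A₋-recurrence {n} n>0 k = #-rank≤-recurrence 0 (k * 3) balance (nonempty k) (λ ())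
  where
  rearrange : ∀ w k → w + (1 + 3 * k) ≡ suc (k * 3) + w
  rearrange = solve-∀
  balance : weight₁ (suc k) ≡ suc (k * 3) + weight₁ k
  balance = trans (Residue₁.sum-firstParts-suc k) (rearrange (weight₁ k) k)
  nonempty : ∀ k → k * 3 ≡ 0 → weight₁ k ≢ n
  nonempty zero _ = <⇒≢ n>0

A₊-recurrence : ∀ n k → A₊ n k + A₊ n (suc k) ≡ p[ n - weight₂ k ]
A₊-recurrence n k = begin
  A₊ n k + A₊ n (suc k)
    ≡⟨ +-comm (A₊ n k) (A₊ n (suc k)) ⟩
  A₊ n (suc k) + A₊ n k
    ≡⟨ cong (A₊ n (suc k) +_) (#-rank≤-cancel n (weight₂ k) (k * 3) 0 3) ⟨
  A₊ n (suc k) + #[ n - weight₂ k ] (rank≤? (3 + k * 3) 3)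
    ≡⟨ #-rank≤-recurrence (suc k * 3) 0 balance (λ ()) (λ ()) ⟩
  p[ n - weight₂ k ] ∎
  where
  open ≡-Reasoning
  rearrange : ∀ w k → suc k * 3 + w ≡ 1 + (w + (2 + 3 * k))
  rearrange = solve-∀
  balance : suc k * 3 + weight₂ k ≡ 1 + weight₂ (suc k)
  balance = trans (rearrange (weight₂ k) k) (cong suc (sym (Residue₂.sum-firstParts-suc k)))

A₋≡pν : ∀ {n} → 0 < n → ∀ ν → A₋ n ν ≡ pν 1 3 ν n
A₋≡pν {n} n>0 = alternating-recurrence-unique n (A₋-recurrence n>0) (Residue₁.pν-recurrence n)
  (λ k n≤k → #-vanishes n (weight₁ (suc k)) U? (≤-trans (s≤s n≤k) (Residue₁.≤-sum-firstParts (suc k))))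

A₊≡pν : ∀ n ν → A₊ n (suc ν) ≡ pν 2 3 ν n
A₊≡pν n = alternating-recurrence-unique n (A₊-recurrence n ∘ suc) (Residue₂.pν-recurrence n)
  (λ k n≤k → #-vanishes n (weight₂ (suc k)) U? (≤-trans (s≤s n≤k) (Residue₂.≤-sum-firstParts (suc k))))

-- Alternating sums

open import Data.Integer using (ℤ; +_; -1ℤ; 1ℤ; _^_; _-_) renaming (_*_ to _*ℤ_; _+_ to _+ℤ_)

-1^k*-1^k≡1 : ∀ k → (-1ℤ ^ k) *ℤ (-1ℤ ^ k) ≡ 1ℤ
-1^k*-1^k≡1 zero    = refl
-1^k*-1^k≡1 (suc k) = trans (signs-cancel (-1ℤ ^ k)) (-1^k*-1^k≡1 k)
  where
  signs-cancel : ∀ s → (-1ℤ *ℤ s) *ℤ (-1ℤ *ℤ s) ≡ s *ℤ s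
  signs-cancel = ℤSolver.solve-∀

sumTo-cong : ∀ k {f g : ℕ → ℤ} → (∀ {j} → j ≤ k → f j ≡ g j) → sumTo k f ≡ sumTo k g
sumTo-cong zero    f≡g = f≡g z≤n
sumTo-cong (suc k) f≡g = cong₂ _+ℤ_ (sumTo-cong k (f≡g ∘ m≤n⇒m≤1+n)) (f≡g ≤-refl)

sumTo-telescope : ∀ (X : ℕ → ℤ) k →
  sumTo k (λ τ → (-1ℤ ^ τ) *ℤ (X τ +ℤ X (suc τ))) ≡ X 0 +ℤ (-1ℤ ^ k) *ℤ X (suc k)
sumTo-telescope X zero    = distribute (X 0) (X 1)
  where
  distribute : ∀ x y → 1ℤ *ℤ (x +ℤ y) ≡ x +ℤ 1ℤ *ℤ y
  distribute = ℤSolver.solve-∀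
sumTo-telescope X (suc k) = begin
  sumTo k (λ τ → (-1ℤ ^ τ) *ℤ (X τ +ℤ X (suc τ))) +ℤ (-1ℤ ^ suc k) *ℤ (X (suc k) +ℤ X (suc (suc k)))
    ≡⟨ cong (_+ℤ (-1ℤ ^ suc k) *ℤ (X (suc k) +ℤ X (suc (suc k)))) (sumTo-telescope X k) ⟩
  (X 0 +ℤ (-1ℤ ^ k) *ℤ X (suc k)) +ℤ (-1ℤ ^ suc k) *ℤ (X (suc k) +ℤ X (suc (suc k)))
    ≡⟨ cancel (X 0) (-1ℤ ^ k) (X (suc k)) (X (suc (suc k))) ⟩
  X 0 +ℤ (-1ℤ ^ suc k) *ℤ X (suc (suc k)) ∎
  where
  open ≡-Reasoning
  cancel : ∀ x s y z → (x +ℤ s *ℤ y) +ℤ (-1ℤ *ℤ s) *ℤ (y +ℤ z) ≡ x +ℤ (-1ℤ *ℤ s) *ℤ z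
  cancel = ℤSolver.solve-∀

alternating-difference : ∀ (X Y : ℕ → ℤ) k → X 0 ≡ Y 0 →
  (-1ℤ ^ suc k) *ℤ
    ( sumTo (suc k) (λ τ → (-1ℤ ^ τ) *ℤ (X τ +ℤ X (suc τ)))
    - sumTo k (λ τ → (-1ℤ ^ τ) *ℤ (Y τ +ℤ Y (suc τ))) )
  ≡ X (suc (suc k)) +ℤ Y (suc k)
alternating-difference X Y k X₀≡Y₀ = begin
  (-1ℤ *ℤ s) *ℤ
    ( sumTo (suc k) (λ τ → (-1ℤ ^ τ) *ℤ (X τ +ℤ X (suc τ)))
    - sumTo k (λ τ → (-1ℤ ^ τ) *ℤ (Y τ +ℤ Y (suc τ))) )
    ≡⟨ cong₂ (λ S T → (-1ℤ *ℤ s) *ℤ (S - T)) (sumTo-telescope X (suc k)) (sumTo-telescope Y k) ⟩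
  (-1ℤ *ℤ s) *ℤ ((X 0 +ℤ (-1ℤ *ℤ s) *ℤ x) - (Y 0 +ℤ s *ℤ y))
    ≡⟨ cong (λ c → (-1ℤ *ℤ s) *ℤ ((c +ℤ (-1ℤ *ℤ s) *ℤ x) - (Y 0 +ℤ s *ℤ y))) X₀≡Y₀ ⟩
  (-1ℤ *ℤ s) *ℤ ((Y 0 +ℤ (-1ℤ *ℤ s) *ℤ x) - (Y 0 +ℤ s *ℤ y))
    ≡⟨ collect s (Y 0) x y ⟩
  (s *ℤ s) *ℤ (x +ℤ y)
    ≡⟨ cong (_*ℤ (x +ℤ y)) (-1^k*-1^k≡1 k) ⟩
  1ℤ *ℤ (x +ℤ y)
    ≡⟨ ℤ.*-identityˡ (x +ℤ y) ⟩
  x +ℤ y ∎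
  where
  open ≡-Reasoning
  s x y : ℤ
  s = -1ℤ ^ k
  x = X (suc (suc k))
  y = Y (suc k)
  collect : ∀ s c x y →
    (-1ℤ *ℤ s) *ℤ ((c +ℤ (-1ℤ *ℤ s) *ℤ x) - (c +ℤ s *ℤ y)) ≡ (s *ℤ s) *ℤ (x +ℤ y)
  collect = ℤSolver.solve-∀

module _ {ν n : ℕ} (bound : ν * (3 * ν + 5) / 2 < n) where

  p-weight₂ : ∀ {τ} → τ ≤ ν → p (n ∸ τ * (3 * τ + 1) / 2) ≡ p[ n - weight₂ τ ]
  p-weight₂ {τ} τ≤ν = trans (p-∸ (≤-trans (/-monoˡ-≤ 2 τ-term≤) (<⇒≤ bound)))
    (cong p[ n -_] (weight₂-formula τ))
    where
    τ-term≤ : τ * (3 * τ + 1) ≤ ν * (3 * ν + 5)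
    τ-term≤ = *-mono-≤ τ≤ν (+-mono-≤ (*-monoʳ-≤ 3 τ≤ν) (s≤s z≤n))

  p-weight₁ : ∀ {τ} → τ ≤ ν → p (n ∸ τ * (3 * τ + 5) / 2 ∸ 1) ≡ p[ n - weight₁ (suc τ) ]
  p-weight₁ {τ} τ≤ν = begin
    p (n ∸ q ∸ 1)              ≡⟨ cong p (∸-+-assoc n q 1) ⟩
    p (n ∸ (q + 1))            ≡⟨ cong (λ e → p (n ∸ e)) (+-comm q 1) ⟩
    p (n ∸ suc q)              ≡⟨ p-∸ (≤-trans (s≤s (/-monoˡ-≤ 2 τ-term≤)) bound) ⟩
    p[ n - suc q ]             ≡⟨ cong p[ n -_] (weight₁-formula τ) ⟩
    p[ n - weight₁ (suc τ) ]   ∎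
    where
    open ≡-Reasoning
    q : ℕ
    q = τ * (3 * τ + 5) / 2
    τ-term≤ : τ * (3 * τ + 5) ≤ ν * (3 * ν + 5)
    τ-term≤ = *-mono-≤ τ≤ν (+-monoˡ-≤ 5 (*-monoʳ-≤ 3 τ≤ν))

theorem1p3 : (ν n : ℕ) → 1 ≤ ν → ν * (3 * ν + 5) / 2 < n →
    (-1ℤ ^ ν) *ℤ
      ( sumTo ν (λ τ → (-1ℤ ^ τ) *ℤ (+ p (n ∸ τ * (3 * τ + 1) / 2)))
      - sumTo (ν ∸ 1) (λ τ → (-1ℤ ^ τ) *ℤ (+ p (n ∸ τ * (3 * τ + 5) / 2 ∸ 1))) )
    ≡ + (pν 2 3 ν n + pν 1 3 ν n)
theorem1p3 ν@(suc k) n _ bound = begin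
  (-1ℤ ^ ν) *ℤ
    ( sumTo ν (λ τ → (-1ℤ ^ τ) *ℤ (+ p (n ∸ τ * (3 * τ + 1) / 2)))
    - sumTo k (λ τ → (-1ℤ ^ τ) *ℤ (+ p (n ∸ τ * (3 * τ + 5) / 2 ∸ 1))) )
    ≡⟨ cong₂ (λ S T → (-1ℤ ^ ν) *ℤ (S - T))
         (sumTo-cong ν (λ {τ} τ≤ν → cong (λ x → (-1ℤ ^ τ) *ℤ (+ x))
           (trans (p-weight₂ bound τ≤ν) (sym (A₊-recurrence n τ)))))
         (sumTo-cong k (λ {τ} τ≤k → cong (λ x → (-1ℤ ^ τ) *ℤ (+ x))
           (trans (p-weight₁ bound (m≤n⇒m≤1+n τ≤k)) (sym (A₋-recurrence n>0 τ))))) ⟩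
  (-1ℤ ^ ν) *ℤ
    ( sumTo ν (λ τ → (-1ℤ ^ τ) *ℤ (+ (A₊ n τ + A₊ n (suc τ))))
    - sumTo k (λ τ → (-1ℤ ^ τ) *ℤ (+ (A₋ n τ + A₋ n (suc τ)))) )
    ≡⟨ alternating-difference (+_ ∘ A₊ n) (+_ ∘ A₋ n) k refl ⟩
  + (A₊ n (suc ν) + A₋ n ν)
    ≡⟨ cong₂ (λ x y → + (x + y)) (A₊≡pν n ν) (A₋≡pν n>0 ν) ⟩
  + (pν 2 3 ν n + pν 1 3 ν n) ∎
  where
  open ≡-Reasoning
  n>0 : 0 < n
  n>0 = ≤-trans z<s bound
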